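{- There exists a constant $c>0$ such that the following holds. Let $G_M$ be the final graph produced by the $Q_2$-free process in the hypercube $Q_d$, and let $v$ be a vertex of $Q_d$ chosen uniformly at random. Then with high probability (i.e. with probability tending to $1$ as $d\to\infty$), the degree of $v$ in $G_M$ is at least $c\,d^{2/3}$.
   Context: $Q_d$ denotes the $d$-dimensional hypercube graph: vertex set $\{0,1\}^d$, two vertices adjacent iff they differ in exactly one coordinate. $Q_2$ is the 4-cycle. The $Q_2$-free process in $Q_d$ is defined as follows: start with $G_0$ the graph on $V(Q_d)$ with no edges; given $G_i$, choose an edge uniformly at random among all edges $e\in E(Q_d)\setminus E(G_i)$ such that $G_i+e$ contains no copy of $Q_2$ (as a subgraph), and let $G_{i+1}=G_i+e$. The process stops at the first $M$ for which no such edge exists; $G_M$ is the resulting graph. Equivalently, take a uniformly random ordering of $E(Q_d)$ and scan the edges in order, adding each edge if it does not create a copy of $Q_2$ with the edges already added. -}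

module Defs where

open import Data.Bool using (Bool; true; false; if_then_else_; _∧_; not)
import Data.Bool as B
open import Data.Nat using (ℕ; zero; suc; _+_; _*_; _^_; _<ᵇ_)
open import Data.Fin using (Fin)
open import Data.List using (List; []; _∷_; map; concatMap; length; filterᵇ; allFin)
open import Data.Bool.ListAction using (any)
open import Data.Vec using (Vec; []; _∷_; lookup; _[_]≔_)
import Data.Vec.Properties as VP
open import Data.Product using (_×_; _,_; proj₁; proj₂)
open import Relation.Nullary using (does)

Vertex : ℕ → Set
Vertex d = Vec Bool d

allV : (d : ℕ) → List (Vertex d)
allV zero    = [] ∷ []
allV (suc d) = concatMap (λ v → (false ∷ v) ∷ (true ∷ v) ∷ []) (allV d)

_=ᵥ_ : ∀ {d} → Vertex d → Vertex d → Bool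
u =ᵥ w = does (VP.≡-dec B._≟_ u w)

-- An (undirected) edge, stored as a pair of its endpoints.
Edge : ℕ → Set
Edge d = Vertex d × Vertex d

-- The edge set of Q_d: each edge {v, v with coordinate i set to 1}
-- for v with v_i = 0; each edge of Q_d appears exactly once.
qEdges : (d : ℕ) → List (Edge d)
qEdges d = concatMap (λ v → concatMap (λ i →
             if lookup v i then [] else ((v , (v [ i ]≔ true)) ∷ [])) (allFin d))
           (allV d)

Graph : ℕ → Set
Graph d = List (Edge d)

adj : ∀ {d} → Graph d → Vertex d → Vertex d → Bool
adj G a b = any (λ e → ((proj₁ e =ᵥ a) ∧ (proj₂ e =ᵥ b)) B.∨ ((proj₁ e =ᵥ b) ∧ (proj₂ e =ᵥ a))) G

distinct4 : ∀ {d} → Vertex d → Vertex d → Vertex d → Vertex d → Bool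
distinct4 a b c e = not (a =ᵥ b) ∧ not (a =ᵥ c) ∧ not (a =ᵥ e)
                  ∧ not (b =ᵥ c) ∧ not (b =ᵥ e) ∧ not (c =ᵥ e)

hasQ2 : ∀ {d} → Graph d → Bool
hasQ2 {d} G =
  any (λ a → any (λ b → any (λ c → any (λ e →
      distinct4 a b c e ∧ adj G a b ∧ adj G b c ∧ adj G c e ∧ adj G e a)
    (allV d)) (allV d)) (allV d)) (allV d)

greedy : ∀ {d} → Graph d → List (Edge d) → Graph d
greedy G []       = G
greedy G (e ∷ es) = if hasQ2 (e ∷ G) then greedy G es else greedy (e ∷ G) es

finalGraph : ∀ {d} → List (Edge d) → Graph d
finalGraph order = greedy [] order

degree : ∀ {d} → Graph d → Vertex d → ℕ
degree G v = length (filterᵇ (λ e → (proj₁ e =ᵥ v) B.∨ (proj₂ e =ᵥ v)) G)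

insertions : ∀ {A : Set} → A → List A → List (List A)
insertions x []       = (x ∷ []) ∷ []
insertions x (y ∷ ys) = (x ∷ y ∷ ys) ∷ map (y ∷_) (insertions x ys)

perms : ∀ {A : Set} → List A → List (List A)
perms []       = [] ∷ []
perms (x ∷ xs) = concatMap (insertions x) (perms xs)

-- Sample space: (uniformly random ordering of E(Q_d), uniformly random vertex v).
samples : (d : ℕ) → List (List (Edge d) × Vertex d)
samples d = concatMap (λ σ → map (σ ,_) (allV d)) (perms (qEdges d))

-- "deg < (p/q) d^{2/3}"  ⇔  (q·deg)^3 < p^3 · d^2
lowDegree : ∀ {d} → ℕ → ℕ → ℕ → Bool
lowDegree {d} p q deg = ((q * deg) ^ 3) <ᵇ ((p ^ 3) * (d ^ 2))

badCount : (d p q : ℕ) → ℕ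
badCount d p q = length (filterᵇ (λ s →
                   lowDegree {d} p q (degree (finalGraph (proj₁ s)) (proj₂ s)))
                   (samples d))

totalCount : ℕ → ℕ
totalCount d = length (samples d)

{-# OPTIONS --safe #-}
module Submission where

open import Defs
open import Data.Bool using (Bool; true; false; if_then_else_; not; _∧_; _∨_; T)
import Data.Bool as Bool
open import Data.Bool.ListAction using (any)
open import Data.Bool.Properties using (T-≡; T-∧; T-∨; not-¬; ∨-zeroʳ)
open import Data.Fin using (Fin)
import Data.Fin as Fin
import Data.Fin.Properties as Fin
open import Data.List using (List; []; _∷_; map; concatMap; length; filterᵇ; filter; _++_; cartesianProduct; take; drop; allFin)
open import Data.List.Membership.Propositional using (_∈_; _∉_; find; lose)
import Data.List.Membership.DecPropositional as DecMembership
open import Data.List.Membership.Propositional.Properties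
  using (∈-++⁺ˡ; ∈-++⁺ʳ; ∈-++⁻; ∈-map⁻; ∈-concatMap⁺; ∈-concatMap⁻; ∈-cartesianProduct⁺; ∈-cartesianProduct⁻; ∈-filter⁺; ∈-filter⁻; ∈-allFin)
open import Data.List.Properties using (map-++; map-∘; length-map; length-tabulate; take++drop≡id)
open import Data.List.Relation.Binary.Subset.Propositional using (_⊆_)
import Data.List.Relation.Binary.Subset.Propositional.Properties as Subset
open import Data.List.Relation.Unary.All using (All; []; _∷_)
import Data.List.Relation.Unary.All as All
open import Data.List.Relation.Unary.AllPairs using ([]; _∷_)
open import Data.List.Relation.Unary.Any using (Any; here; there)
import Data.List.Relation.Unary.Any as Any
open import Data.List.Relation.Unary.Any.Properties using (any⁺; any⁻)
open import Data.List.Relation.Unary.Unique.Propositional using (Unique)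
import Data.List.Relation.Unary.Unique.Propositional.Properties as Unique
open import Data.Nat
open import Data.Nat.DivMod using (_/_; _%_; m≡m%n+[m/n]*n; m/n*n≤m; m%n<n; m≥n⇒m/n>0; m/n≤m)
open import Data.Nat.ListAction using (sum)
open import Data.Nat.ListAction.Properties using (sum-++)
open import Data.Nat.Properties
open import Data.Nat.Tactic.RingSolver using (solve-∀)
open import Data.Product using (Σ; _×_; _,_; proj₁; proj₂; ∃-syntax)
import Data.Product.Properties as Product
open import Data.Sum using (_⊎_; inj₁; inj₂)
import Data.Sum as Sum
open import Data.Vec using (Vec; []; _∷_; lookup; replicate; _[_]≔_; _[_]%=_)
import Data.Vec.Properties as Vec
open import Function using (_∘_; id)
open import Function.Bundles using (Equivalence)
open import Level using (0ℓ)
open import Relation.Binary using (DecidableEquality)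
open import Relation.Binary.PropositionalEquality using (_≡_; _≢_; refl; sym; trans; cong; cong₂; subst; ≢-sym; module ≡-Reasoning)
open import Relation.Nullary using (Dec; does; yes; no; ¬_; contradiction; ¬?)
open import Relation.Nullary.Decidable using (dec-true; dec-false)
open import Relation.Unary using (Pred; Decidable)

-- Fix a vertex v and let S be the set of the first m = N / r edges of the ordering, where
-- N = |E(Q_d)| and r = Θ(d^{1/3}) with a large enough constant. If Y edges at v lie in S and X is
-- the number of ordered pairs (i , j) of directions for which the whole 4-cycle at v in directions
-- i , j lies in S, then deg v ≥ Y − X: an edge at v in S that is refused closes a 4-cycle inside S.
-- E Y = Θ(d / r), and E X ≤ d² / r⁴ is a small fraction of it. Both variances are O(d / r), since
-- disjoint sets of edges are negatively correlated under a uniform ordering and two distinct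
-- 4-cycles at v that share an edge have seven edges altogether. Chebyshev's inequality then gives
-- failure probability O(r / d) = o(1).

-- The size of r is forced: the loss d² / r⁴ stays below the gain d / r exactly when r³ is at least
-- a constant times d, and the smallest such r leaves d / r of order d^{2/3}. The process need not
-- be followed step by step, because the graph it holds while scanning S is contained in S; counting
-- all 4-cycles inside S can only overestimate the loss. Probabilities stay unnormalised: a count of
-- orderings stands for that count divided by the number of all orderings, so each estimate is an
-- inequality between natural numbers. Constants: r = 4 s with d ≤ s³ ≤ 8 d. Then E Y ≥ d / (2 r)
-- and E X ≤ d / (64 r). Outside the events Y ≤ d / (4 r) and X ≥ d / (8 r) the degree is at least d
-- / (8 r) = d / (32 s), and s ≤ 2 d^{1/3} turns this into d^{2/3} / 64.

private variable
  A B : Set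
  d : ℕ

-- Sums over lists and counting permutations

𝟙 : Bool → ℕ
𝟙 b = if b then 1 else 0

𝟙≤1 : ∀ b → 𝟙 b ≤ 1
𝟙≤1 true  = ≤-refl
𝟙≤1 false = z≤n

∑ : List A → (A → ℕ) → ℕ
∑ xs f = sum (map f xs)

syntax ∑ xs (λ x → e) = ∑[ x ∈ xs ] e

∑-cong : (xs : List A) {f g : A → ℕ} → (∀ x → x ∈ xs → f x ≡ g x) → ∑ xs f ≡ ∑ xs g
∑-cong []       eq = refl
∑-cong (x ∷ xs) eq = cong₂ _+_ (eq x (here refl)) (∑-cong xs (λ y y∈ → eq y (there y∈)))

∑-mono : (xs : List A) {f g : A → ℕ} → (∀ x → x ∈ xs → f x ≤ g x) → ∑ xs f ≤ ∑ xs g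
∑-mono []       le = z≤n
∑-mono (x ∷ xs) le = +-mono-≤ (le x (here refl)) (∑-mono xs (λ y y∈ → le y (there y∈)))

∑-++ : (xs ys : List A) (f : A → ℕ) → ∑ (xs ++ ys) f ≡ ∑ xs f + ∑ ys f
∑-++ xs ys f = trans (cong sum (map-++ f xs ys)) (sum-++ (map f xs) (map f ys))

∑-map : (g : A → B) (xs : List A) (f : B → ℕ) → ∑ (map g xs) f ≡ ∑ xs (f ∘ g)
∑-map g xs f = cong sum (sym (map-∘ xs))

∑-concatMap : (g : A → List B) (xs : List A) (f : B → ℕ) →
              ∑ (concatMap g xs) f ≡ ∑[ x ∈ xs ] ∑ (g x) f
∑-concatMap g []       f = refl
∑-concatMap g (x ∷ xs) f =
  trans (∑-++ (g x) (concatMap g xs) f) (cong (∑ (g x) f +_) (∑-concatMap g xs f))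

∑-distrib-+ : (xs : List A) (f g : A → ℕ) → ∑[ x ∈ xs ] (f x + g x) ≡ ∑ xs f + ∑ xs g
∑-distrib-+ []       f g = refl
∑-distrib-+ (x ∷ xs) f g =
  trans (cong (f x + g x +_) (∑-distrib-+ xs f g)) (interchange (f x) (g x) (∑ xs f) (∑ xs g))
  where
  interchange : ∀ a b c d → a + b + (c + d) ≡ a + c + (b + d)
  interchange = solve-∀

∑-*ˡ : (xs : List A) (c : ℕ) (f : A → ℕ) → ∑[ x ∈ xs ] (c * f x) ≡ c * ∑ xs f
∑-*ˡ []       c f = sym (*-zeroʳ c)
∑-*ˡ (x ∷ xs) c f = trans (cong (c * f x +_) (∑-*ˡ xs c f)) (sym (*-distribˡ-+ c (f x) (∑ xs f)))

∑-*ʳ : (xs : List A) (c : ℕ) (f : A → ℕ) → ∑[ x ∈ xs ] (f x * c) ≡ ∑ xs f * c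
∑-*ʳ xs c f = trans (∑-cong xs (λ x _ → *-comm (f x) c))
             (trans (∑-*ˡ xs c f) (*-comm c (∑ xs f)))

∑-const : (xs : List A) (c : ℕ) → ∑[ _ ∈ xs ] c ≡ length xs * c
∑-const []       c = refl
∑-const (x ∷ xs) c = cong (c +_) (∑-const xs c)

∑-swap : (xs : List A) (ys : List B) (f : A → B → ℕ) →
         ∑[ x ∈ xs ] ∑[ y ∈ ys ] f x y ≡ ∑[ y ∈ ys ] ∑[ x ∈ xs ] f x y
∑-swap []       ys f = sym (trans (∑-const ys 0) (*-zeroʳ (length ys)))
∑-swap (x ∷ xs) ys f = trans (cong (∑ ys (f x) +_) (∑-swap xs ys f))
                             (sym (∑-distrib-+ ys (f x) _))

∑-*-∑ : (xs : List A) (ys : List B) (f : A → ℕ) (g : B → ℕ) →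
        ∑[ x ∈ xs ] ∑[ y ∈ ys ] (f x * g y) ≡ ∑ xs f * ∑ ys g
∑-*-∑ xs ys f g = trans (∑-cong xs (λ x _ → ∑-*ˡ ys (f x) g)) (∑-*ʳ xs (∑ ys g) f)

term≤∑ : {xs : List A} {x : A} (f : A → ℕ) → x ∈ xs → f x ≤ ∑ xs f
term≤∑ {xs = y ∷ ys} f (here refl) = m≤m+n (f y) _
term≤∑ {xs = y ∷ ys} f (there x∈)  = ≤-trans (term≤∑ f x∈) (m≤n+m _ (f y))

∑-cartesianProduct : (xs : List A) (ys : List B) (f : A × B → ℕ) →
                     ∑ (cartesianProduct xs ys) f ≡ ∑[ x ∈ xs ] ∑[ y ∈ ys ] f (x , y)
∑-cartesianProduct []       ys f = refl
∑-cartesianProduct (x ∷ xs) ys f =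
  trans (∑-++ (map (x ,_) ys) _ f) (cong₂ _+_ (∑-map (x ,_) ys f) (∑-cartesianProduct xs ys f))

∑-filter≤ : {P : Pred A 0ℓ} (P? : Decidable P) (xs : List A) (f : A → ℕ) →
            ∑ (filter P? xs) f ≤ ∑ xs f
∑-filter≤ P? []       f = z≤n
∑-filter≤ P? (x ∷ xs) f with does (P? x)
... | true  = +-monoʳ-≤ (f x) (∑-filter≤ P? xs f)
... | false = ≤-trans (∑-filter≤ P? xs f) (m≤n+m _ (f x))

length-filterᵇ : (p : A → Bool) (xs : List A) → length (filterᵇ p xs) ≡ ∑[ x ∈ xs ] 𝟙 (p x)
length-filterᵇ p []       = refl
length-filterᵇ p (x ∷ xs) with p x
... | true  = cong suc (length-filterᵇ p xs)
... | false = length-filterᵇ p xs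

length-∑ : (xs : List A) → length xs ≡ ∑[ _ ∈ xs ] 1
length-∑ xs = sym (trans (∑-const xs 1) (*-identityʳ (length xs)))

-- Equals 1 if no element of positions m, m+1, … of the list satisfies χ, and 0 otherwise.
clear : (A → Bool) → ℕ → List A → ℕ
clear χ m       []       = 1
clear χ zero    (x ∷ xs) = 𝟙 (not (χ x)) * clear χ zero xs
clear χ (suc m) (x ∷ xs) = clear χ m xs

length-insertion : {x : A} (xs : List A) {ys : List A} → ys ∈ insertions x xs → length ys ≡ suc (length xs)
length-insertion []       (here refl) = refl
length-insertion (y ∷ xs) (here refl) = refl
length-insertion {x = x} (y ∷ xs) (there ys∈) with ∈-map⁻ (y ∷_) ys∈
... | zs , zs∈ , refl = cong suc (length-insertion xs zs∈)

∈-perms-∷ : {x : A} {xs ys : List A} → ys ∈ perms (x ∷ xs) →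
            ∃[ zs ] zs ∈ perms xs × ys ∈ insertions x zs
∈-perms-∷ {x = x} {xs} ys∈ = find′ (∈-concatMap⁻ (insertions x) {xs = perms xs} ys∈)
  where
  find′ : ∀ {P : Pred (List _) 0ℓ} {xss} → Any P xss → ∃[ zs ] zs ∈ xss × P zs
  find′ (here p)  = _ , here refl , p
  find′ (there p) with find′ p
  ... | zs , zs∈ , q = zs , there zs∈ , q

length-perm : (xs : List A) {σ : List A} → σ ∈ perms xs → length σ ≡ length xs
length-perm []       (here refl) = refl
length-perm (x ∷ xs) σ∈ with ∈-perms-∷ {xs = xs} σ∈
... | τ , τ∈ , σ∈′ = trans (length-insertion τ σ∈′) (cong suc (length-perm xs τ∈))

∑-insertion : {x : A} (ys : List A) (f : A → ℕ) {τ : List A} → τ ∈ insertions x ys → ∑ τ f ≡ f x + ∑ ys f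
∑-insertion []       f (here refl) = refl
∑-insertion (y ∷ ys) f (here refl) = refl
∑-insertion {x = x} (y ∷ ys) f (there τ∈) with ∈-map⁻ (y ∷_) τ∈
... | τ′ , τ′∈ , refl = trans (cong (f y +_) (∑-insertion ys f τ′∈)) (swap₃ (f y) (f x) (∑ ys f))
  where
  swap₃ : ∀ a b c → a + (b + c) ≡ b + (a + c)
  swap₃ = solve-∀

∑-perm : (xs : List A) (f : A → ℕ) {σ : List A} → σ ∈ perms xs → ∑ σ f ≡ ∑ xs f
∑-perm []       f (here refl) = refl
∑-perm (x ∷ xs) f σ∈ with ∈-perms-∷ {xs = xs} σ∈
... | τ , τ∈ , σ∈′ = trans (∑-insertion τ f σ∈′) (cong (f x +_) (∑-perm xs f τ∈))

-- With m = 0 every position counts as late, so the value is a product over all elements and is the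
-- same for each of the `suc (length σ)` insertion places.
∑-insertions-clear₀ : (χ : A → Bool) (x : A) (σ : List A) →
  ∑ (insertions x σ) (clear χ 0) ≡ suc (length σ) * (𝟙 (not (χ x)) * clear χ 0 σ)
∑-insertions-clear₀ χ x []       = refl
∑-insertions-clear₀ χ x (y ∷ σ) = begin
  a * (b * c) + ∑ (map (y ∷_) (insertions x σ)) (clear χ 0)
    ≡⟨ cong (a * (b * c) +_) (trans (∑-map (y ∷_) (insertions x σ) (clear χ 0)) (∑-*ˡ (insertions x σ) b (clear χ 0))) ⟩
  a * (b * c) + b * ∑ (insertions x σ) (clear χ 0)
    ≡⟨ cong (λ z → a * (b * c) + b * z) (∑-insertions-clear₀ χ x σ) ⟩
  a * (b * c) + b * (suc (length σ) * (a * c))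
    ≡⟨ rearrange a b c (length σ) ⟩
  suc (suc (length σ)) * (a * (b * c)) ∎
  where
  open ≡-Reasoning
  a = 𝟙 (not (χ x))
  b = 𝟙 (not (χ y))
  c = clear χ 0 σ
  rearrange : ∀ a b c l → a * (b * c) + b * ((1 + l) * (a * c)) ≡ (2 + l) * (a * (b * c))
  rearrange = solve-∀

-- In one of the m early places x is unconstrained, but it pushes the entry of σ at position m - 1
-- out of the early segment, hence `pred m`. In one of the n late places σ keeps its early segment
-- and x itself must fail χ. For m = 0 the value of `pred` is multiplied by zero.
∑-insertions-clear : (χ : A → Bool) (x : A) (m n : ℕ) (σ : List A) → suc (length σ) ≡ m + n →
  ∑ (insertions x σ) (clear χ m) ≡ m * clear χ (pred m) σ + n * (𝟙 (not (χ x)) * clear χ m σ)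
∑-insertions-clear χ x zero    n σ        eq =
  trans (∑-insertions-clear₀ χ x σ) (cong (_* (𝟙 (not (χ x)) * clear χ 0 σ)) eq)
∑-insertions-clear χ x (suc zero) zero [] eq = refl
∑-insertions-clear χ x (suc zero) (suc n) [] ()
∑-insertions-clear χ x (suc (suc m)) n [] ()
∑-insertions-clear χ x (suc m) n (y ∷ σ) eq = begin
  clear χ m (y ∷ σ) + ∑ (map (y ∷_) (insertions x σ)) (clear χ (suc m))
    ≡⟨ cong (clear χ m (y ∷ σ) +_) (∑-map (y ∷_) (insertions x σ) (clear χ (suc m))) ⟩
  clear χ m (y ∷ σ) + ∑ (insertions x σ) (clear χ m)
    ≡⟨ cong (clear χ m (y ∷ σ) +_) (∑-insertions-clear χ x m n σ (suc-injective eq)) ⟩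
  clear χ m (y ∷ σ) + (m * clear χ (pred m) σ + n * (𝟙 (not (χ x)) * clear χ m σ))
    ≡⟨ cong (λ z → clear χ m (y ∷ σ) + (z + n * (𝟙 (not (χ x)) * clear χ m σ))) (shift m) ⟩
  clear χ m (y ∷ σ) + (m * clear χ m (y ∷ σ) + n * (𝟙 (not (χ x)) * clear χ m σ))
    ≡⟨ sym (+-assoc (clear χ m (y ∷ σ)) (m * clear χ m (y ∷ σ)) _) ⟩
  suc m * clear χ m (y ∷ σ) + n * (𝟙 (not (χ x)) * clear χ m σ) ∎
  where
  open ≡-Reasoning
  shift : ∀ m → m * clear χ (pred m) σ ≡ m * clear χ m (y ∷ σ)
  shift zero    = refl
  shift (suc m) = refl

∑-perms-∷-clear : (χ : A → Bool) (x : A) (xs : List A) (m n : ℕ) → suc (length xs) ≡ m + n →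
  ∑ (perms (x ∷ xs)) (clear χ m)
    ≡ m * ∑ (perms xs) (clear χ (pred m)) + n * (𝟙 (not (χ x)) * ∑ (perms xs) (clear χ m))
∑-perms-∷-clear χ x xs m n eq = begin
  ∑ (perms (x ∷ xs)) (clear χ m)
    ≡⟨ ∑-concatMap (insertions x) (perms xs) (clear χ m) ⟩
  ∑[ σ ∈ perms xs ] ∑ (insertions x σ) (clear χ m)
    ≡⟨ ∑-cong (perms xs) (λ σ σ∈ → ∑-insertions-clear χ x m n σ (trans (cong suc (length-perm xs σ∈)) eq)) ⟩
  ∑[ σ ∈ perms xs ] (m * clear χ (pred m) σ + n * (a * clear χ m σ))
    ≡⟨ ∑-distrib-+ (perms xs) _ _ ⟩
  ∑[ σ ∈ perms xs ] (m * clear χ (pred m) σ) + ∑[ σ ∈ perms xs ] (n * (a * clear χ m σ))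
    ≡⟨ cong₂ _+_ (∑-*ˡ (perms xs) m _)
         (trans (∑-*ˡ (perms xs) n _) (cong (n *_) (∑-*ˡ (perms xs) a _))) ⟩
  m * ∑ (perms xs) (clear χ (pred m)) + n * (a * ∑ (perms xs) (clear χ m)) ∎
  where
  open ≡-Reasoning
  a = 𝟙 (not (χ x))

falling : ℕ → ℕ → ℕ
falling m       zero    = 1
falling zero    (suc k) = 0
falling (suc m) (suc k) = suc m * falling m k

-- The recurrence with factor m - k, written additively. It also holds for k > m, where both
-- `falling` terms vanish.
falling-suc : ∀ m k → falling m (suc k) + k * falling m k ≡ m * falling m k
falling-suc zero    zero    = refl
falling-suc zero    (suc k) = *-zeroʳ k
falling-suc (suc m) zero    = +-identityʳ _
falling-suc (suc m) (suc k) = begin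
  suc m * falling m (suc k) + suc k * (suc m * falling m k)
    ≡⟨ e₁ m k (falling m (suc k)) (falling m k) ⟩
  suc m * (falling m (suc k) + k * falling m k + falling m k)
    ≡⟨ cong (λ z → suc m * (z + falling m k)) (falling-suc m k) ⟩
  suc m * (m * falling m k + falling m k)
    ≡⟨ e₂ m (falling m k) ⟩
  suc m * (suc m * falling m k) ∎
  where
  open ≡-Reasoning
  e₁ : ∀ m k a b → (1 + m) * a + (1 + k) * ((1 + m) * b) ≡ (1 + m) * (a + k * b + b)
  e₁ = solve-∀
  e₂ : ∀ m b → (1 + m) * (m * b + b) ≡ (1 + m) * ((1 + m) * b)
  e₂ = solve-∀

falling-pred : ∀ m k → m * falling (pred m) k ≡ falling m (suc k)
falling-pred zero    k = refl
falling-pred (suc m) k = refl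

-- The k marked elements choose distinct early positions in `falling m k` ways and the other l are
-- ordered freely. The induction removes the first element of the list: a marked one may only enter
-- an early place, an unmarked one may enter any place.
∑-perms-clear : (χ : A → Bool) (xs : List A) (m n k l : ℕ) →
  length xs ≡ m + n → ∑[ x ∈ xs ] 𝟙 (χ x) ≡ k → k + l ≡ m + n →
  ∑ (perms xs) (clear χ m) ≡ falling m k * l !
∑-perms-clear χ [] zero zero k l eq refl refl = refl
∑-perms-clear χ (x ∷ xs) m n k l eq keq leq with χ x | ∑-perms-∷-clear χ x xs m n eq
∑-perms-clear χ (x ∷ xs) zero n k l eq refl leq | true | rec =
  trans rec (*-zeroʳ n)
∑-perms-clear χ (x ∷ xs) (suc m) n (suc k) l eq keq leq | true | rec = begin
  ∑ (perms (x ∷ xs)) (clear χ (suc m)) ≡⟨ rec ⟩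
  suc m * ∑ (perms xs) (clear χ m) + n * 0
    ≡⟨ cong₂ (λ a b → suc m * a + b)
         (∑-perms-clear χ xs m n k l (suc-injective eq) (suc-injective keq) (suc-injective leq)) (*-zeroʳ n) ⟩
  suc m * (falling m k * l !) + 0 ≡⟨ +-identityʳ _ ⟩
  suc m * (falling m k * l !) ≡⟨ sym (*-assoc (suc m) (falling m k) (l !)) ⟩
  suc m * falling m k * l ! ∎
  where open ≡-Reasoning
∑-perms-clear χ (x ∷ xs) m n k l eq keq leq | false | rec = main l leq
  where
  open ≡-Reasoning
  count≤length : ∀ xs → ∑[ x ∈ xs ] 𝟙 (χ x) ≤ length xs
  count≤length xs = ≤-trans (∑-mono xs (λ x _ → 𝟙≤1 (χ x))) (≤-reflexive (sym (length-∑ xs)))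
  first : ∀ l m n → suc (length xs) ≡ m + n → k + suc l ≡ m + n →
          m * ∑ (perms xs) (clear χ (pred m)) ≡ m * (falling (pred m) k * l !)
  first l zero    n eq leq = refl
  first l (suc m) n eq leq = cong (suc m *_)
    (∑-perms-clear χ xs m n k l (suc-injective eq) keq (suc-injective (trans (sym (+-suc k l)) leq)))
  second : ∀ l m n → suc (length xs) ≡ m + n → k + suc l ≡ m + n →
           n * ∑ (perms xs) (clear χ m) ≡ n * (falling m k * l !)
  second l m zero    eq leq = refl
  second l m (suc n) eq leq = cong (suc n *_)
    (∑-perms-clear χ xs m n k l (suc-injective (trans eq (+-suc m n))) keq
      (suc-injective (trans (sym (+-suc k l)) (trans leq (+-suc m n)))))
  main : ∀ l → k + l ≡ m + n → ∑ (perms (x ∷ xs)) (clear χ m) ≡ falling m k * l !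
  -- With l = 0 all elements would be marked, but x is not.
  main zero    leq = contradiction (trans eq (trans (sym leq) (+-identityʳ k)))
                       (>⇒≢ (s≤s (≤-trans (≤-reflexive (sym keq)) (count≤length xs))))
  main (suc l) leq = begin
    ∑ (perms (x ∷ xs)) (clear χ m)
      ≡⟨ rec ⟩
    m * ∑ (perms xs) (clear χ (pred m)) + n * (1 * ∑ (perms xs) (clear χ m))
      ≡⟨ cong₂ _+_ (first l m n eq leq)
           (trans (cong (n *_) (*-identityˡ _)) (second l m n eq leq)) ⟩
    m * (falling (pred m) k * l !) + n * (falling m k * l !)
      ≡⟨ cong (_+ n * (falling m k * l !)) (trans (sym (*-assoc m _ (l !))) (cong (_* l !) (falling-pred m k))) ⟩
    falling m (suc k) * l ! + n * (falling m k * l !)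
      -- Adding k copies to both sides gives the left side of `falling-suc`, and then m + n = k +
      -- suc l splits the total.
      ≡⟨ +-cancelˡ-≡ (k * (falling m k * l !)) _ _ collect ⟩
    falling m k * (suc l * l !) ∎
    where
    F = falling m k
    regroup : ∀ k n G F f → k * (F * f) + (G * f + n * (F * f)) ≡ (G + k * F) * f + n * (F * f)
    regroup = solve-∀
    merge : ∀ m n F f → m * F * f + n * (F * f) ≡ (m + n) * (F * f)
    merge = solve-∀
    split : ∀ k l F f → (k + (1 + l)) * (F * f) ≡ k * (F * f) + F * ((1 + l) * f)
    split = solve-∀
    collect : k * (F * l !) + (falling m (suc k) * l ! + n * (F * l !)) ≡ k * (F * l !) + F * (suc l * l !)
    collect = begin
      k * (F * l !) + (falling m (suc k) * l ! + n * (F * l !)) ≡⟨ regroup k n (falling m (suc k)) F (l !) ⟩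
      (falling m (suc k) + k * F) * l ! + n * (F * l !) ≡⟨ cong (λ z → z * l ! + n * (F * l !)) (falling-suc m k) ⟩
      m * F * l ! + n * (F * l !) ≡⟨ merge m n F (l !) ⟩
      (m + n) * (F * l !) ≡⟨ cong (_* (F * l !)) (sym leq) ⟩
      (k + suc l) * (F * l !) ≡⟨ split k l F (l !) ⟩
      k * (F * l !) + F * (suc l * l !) ∎

-- Concentration of the number of early sets

falling-suc-∸ : ∀ m k → falling m (suc k) ≡ (m ∸ k) * falling m k
falling-suc-∸ m k = begin
  falling m (suc k)                               ≡⟨ sym (m+n∸n≡m _ (k * falling m k)) ⟩
  falling m (suc k) + k * falling m k ∸ k * falling m k ≡⟨ cong (_∸ k * falling m k) (falling-suc m k) ⟩
  m * falling m k ∸ k * falling m k               ≡⟨ sym (*-distribʳ-∸ (falling m k) m k) ⟩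
  (m ∸ k) * falling m k                           ∎
  where open ≡-Reasoning

-- Negative correlation: with N = l + (k₁ + k₂), the probability that k₁ + k₂ given elements
-- lie among the first m of N is at most the product of those for k₁ and for k₂ elements.
falling-submultiplicative : ∀ m k₁ k₂ l → m ≤ l + (k₁ + k₂) →
  falling m (k₁ + k₂) * l ! * (l + (k₁ + k₂)) ! ≤ (falling m k₁ * (l + k₂) !) * (falling m k₂ * (l + k₁) !)
falling-submultiplicative m zero     k₂ l m≤ rewrite +-identityʳ l =
  ≤-reflexive (rearrange (falling m k₂) (l !) ((l + k₂) !))
  where
  rearrange : ∀ a b c → a * b * c ≡ (1 * c) * (a * b)
  rearrange = solve-∀
falling-submultiplicative m (suc k₁) k₂ l m≤
  rewrite +-suc l (k₁ + k₂) | +-suc l k₁ | falling-suc-∸ m (k₁ + k₂) | falling-suc-∸ m k₁ =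
  -- The factor `suc l` turns `l !` into `suc l !`, so that the induction hypothesis applies with
  -- one more unconstrained element.
  *-cancelˡ-≤ (suc l) (begin
    suc l * ((m ∸ (k₁ + k₂)) * falling m (k₁ + k₂) * l ! * suc (l + (k₁ + k₂)) !)
      ≡⟨ e₁ l (m ∸ (k₁ + k₂)) (falling m (k₁ + k₂)) (l !) (suc (l + (k₁ + k₂)) !) ⟩
    (m ∸ (k₁ + k₂)) * (falling m (k₁ + k₂) * suc l ! * suc (l + (k₁ + k₂)) !)
      ≤⟨ *-monoʳ-≤ (m ∸ (k₁ + k₂)) (falling-submultiplicative m k₁ k₂ (suc l) m≤) ⟩
    (m ∸ (k₁ + k₂)) * ((falling m k₁ * suc (l + k₂) !) * (falling m k₂ * suc (l + k₁) !))
      ≡⟨ e₂ (m ∸ (k₁ + k₂)) (falling m k₁) (l + k₂) ((l + k₂) !) (falling m k₂ * suc (l + k₁) !) ⟩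
    ((m ∸ (k₁ + k₂)) * suc (l + k₂)) * (falling m k₁ * (l + k₂) ! * (falling m k₂ * suc (l + k₁) !))
      ≤⟨ *-monoˡ-≤ (falling m k₁ * (l + k₂) ! * (falling m k₂ * suc (l + k₁) !)) factor ⟩
    ((m ∸ k₁) * suc l) * (falling m k₁ * (l + k₂) ! * (falling m k₂ * suc (l + k₁) !))
      ≡⟨ e₃ l (m ∸ k₁) (falling m k₁) ((l + k₂) !) (falling m k₂ * suc (l + k₁) !) ⟩
    suc l * ((m ∸ k₁) * falling m k₁ * (l + k₂) ! * (falling m k₂ * suc (l + k₁) !)) ∎)
  where
  open ≤-Reasoning
  e₁ : ∀ l a F f g → (1 + l) * (a * F * f * g) ≡ a * (F * ((1 + l) * f) * g)
  e₁ = solve-∀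
  e₂ : ∀ a F n f z → a * ((F * ((1 + n) * f)) * z) ≡ (a * (1 + n)) * (F * f * z)
  e₂ = solve-∀
  e₃ : ∀ l a F f z → (a * (1 + l)) * (F * f * z) ≡ (1 + l) * (a * F * f * z)
  e₃ = solve-∀
  -- The source of the negative correlation: subtracting k₂ from both terms of a fraction that is at
  -- most 1 cannot increase it, so (M - k₂) / M ≤ (l + 1) / (l + 1 + k₂).
  shrink : ∀ M → M ≤ k₂ + suc l → (M ∸ k₂) * suc (l + k₂) ≤ M * suc l
  shrink M M≤ with ≤-total M k₂
  ... | inj₁ M≤k₂ rewrite m≤n⇒m∸n≡0 M≤k₂ = z≤n
  ... | inj₂ k₂≤M = begin
    a * suc (l + k₂)       ≡⟨ e₄ a l k₂ ⟩
    a * suc l + a * k₂     ≤⟨ +-monoʳ-≤ (a * suc l) (*-monoˡ-≤ k₂ (m≤n+o⇒m∸n≤o M k₂ M≤)) ⟩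
    a * suc l + suc l * k₂ ≡⟨ e₅ a l k₂ ⟩
    (a + k₂) * suc l       ≡⟨ cong (_* suc l) (m∸n+n≡m k₂≤M) ⟩
    M * suc l              ∎
    where
    a = M ∸ k₂
    e₄ : ∀ a l k → a * (1 + (l + k)) ≡ a * (1 + l) + a * k
    e₄ = solve-∀
    e₅ : ∀ a l k → a * (1 + l) + (1 + l) * k ≡ (a + k) * (1 + l)
    e₅ = solve-∀
  factor : (m ∸ (k₁ + k₂)) * suc (l + k₂) ≤ (m ∸ k₁) * suc l
  factor = subst (λ z → z * suc (l + k₂) ≤ (m ∸ k₁) * suc l) (∸-+-assoc m k₁ k₂)
    (shrink (m ∸ k₁) (m≤n+o⇒m∸n≤o m k₁ (≤-trans m≤ (≤-reflexive (e₆ l k₁ k₂)))))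
    where
    e₆ : ∀ l k₁ k₂ → 1 + (l + (k₁ + k₂)) ≡ k₁ + (k₂ + (1 + l))
    e₆ = solve-∀

-- Divided by `(k + l) !`, the left side without its power of r is the product of the k ratios (m -
-- j) / (k + l - j), and each is at most 1 / r because m / (k + l) is.
falling-power : ∀ m r .{{_ : NonZero r}} k l → m * r ≤ k + l → falling m k * l ! * r ^ k ≤ (k + l) !
falling-power m r zero    l mr≤ = ≤-reflexive (trans (*-identityʳ _) (*-identityˡ (l !)))
falling-power m r (suc k) l mr≤ rewrite falling-suc-∸ m k = begin
  (m ∸ k) * falling m k * l ! * (r * r ^ k) ≡⟨ e₁ (m ∸ k) (falling m k) (l !) r (r ^ k) ⟩
  ((m ∸ k) * r) * (falling m k * l ! * r ^ k) ≤⟨ *-monoˡ-≤ _ step ⟩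
  suc l * (falling m k * l ! * r ^ k) ≡⟨ e₂ l (falling m k) (l !) (r ^ k) ⟩
  falling m k * suc l ! * r ^ k ≤⟨ falling-power m r k (suc l) (≤-trans mr≤ (≤-reflexive (sym (+-suc k l)))) ⟩
  (k + suc l) ! ≡⟨ cong _! (+-suc k l) ⟩
  suc (k + l) ! ∎
  where
  open ≤-Reasoning
  e₁ : ∀ a F f r p → a * F * f * (r * p) ≡ (a * r) * (F * f * p)
  e₁ = solve-∀
  e₂ : ∀ l F f p → (1 + l) * (F * f * p) ≡ F * ((1 + l) * f) * p
  e₂ = solve-∀
  step : (m ∸ k) * r ≤ suc l
  step = begin
    (m ∸ k) * r        ≡⟨ *-distribʳ-∸ r m k ⟩
    m * r ∸ k * r      ≤⟨ ∸-mono mr≤ (m≤m*n k r) ⟩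
    suc (k + l) ∸ k    ≡⟨ cong (_∸ k) (sym (+-suc k l)) ⟩
    k + suc l ∸ k      ≡⟨ m+n∸m≡n k (suc l) ⟩
    suc l              ∎

-- Chebyshev's inequality without division

∣-∣-square : ∀ a b → ∣ a - b ∣ * ∣ a - b ∣ + 2 * (a * b) ≡ a * a + b * b
∣-∣-square zero    b       = +-identityʳ (b * b)
∣-∣-square (suc a) zero    = cong (λ z → suc a * suc a + 2 * z) (*-zeroʳ a)
∣-∣-square (suc a) (suc b) = begin
  D * D + 2 * (suc a * suc b)         ≡⟨ e₁ D a b ⟩
  D * D + 2 * (a * b) + 2 * (a + b + 1) ≡⟨ cong (_+ 2 * (a + b + 1)) (∣-∣-square a b) ⟩
  a * a + b * b + 2 * (a + b + 1)     ≡⟨ e₂ a b ⟩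
  suc a * suc a + suc b * suc b       ∎
  where
  open ≡-Reasoning
  D = ∣ a - b ∣
  e₁ : ∀ D a b → D * D + 2 * ((1 + a) * (1 + b)) ≡ D * D + 2 * (a * b) + 2 * (a + b + 1)
  e₁ = solve-∀
  e₂ : ∀ a b → a * a + b * b + 2 * (a + b + 1) ≡ (1 + a) * (1 + a) + (1 + b) * (1 + b)
  e₂ = solve-∀

-- All denominators are cleared. With T = `length Ω`, R / T bounds the variance of f, and a bad ω
-- deviates from the mean by at least t / (c T).
chebyshev : (Ω : List A) (f : A → ℕ) (bad : A → Bool) (c t R : ℕ) →
  length Ω * ∑[ ω ∈ Ω ] (f ω * f ω) ≤ ∑ Ω f * ∑ Ω f + length Ω * R →
  (∀ ω → ω ∈ Ω → bad ω ≡ true → t ≤ c * ∣ length Ω * f ω - ∑ Ω f ∣) →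
  ∑[ ω ∈ Ω ] 𝟙 (bad ω) * (t * t) ≤ c * c * (length Ω * length Ω * R)
chebyshev Ω f bad c t R secondMoment deviates = begin
  ∑[ ω ∈ Ω ] 𝟙 (bad ω) * (t * t)           ≡⟨ sym (∑-*ʳ Ω (t * t) _) ⟩
  ∑[ ω ∈ Ω ] (𝟙 (bad ω) * (t * t))         ≤⟨ ∑-mono Ω pointwise ⟩
  ∑[ ω ∈ Ω ] (c * c * (D ω * D ω))         ≡⟨ ∑-*ˡ Ω (c * c) _ ⟩
  c * c * ∑[ ω ∈ Ω ] (D ω * D ω)           ≤⟨ *-monoʳ-≤ (c * c) variance ⟩
  c * c * (∣Ω∣ * ∣Ω∣ * R)                      ∎
  where
  open ≤-Reasoning
  ∣Ω∣ = length Ω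
  S = ∑ Ω f
  S₂ = ∑[ ω ∈ Ω ] (f ω * f ω)
  D : _ → ℕ
  D ω = ∣ ∣Ω∣ * f ω - S ∣
  pointwise : ∀ ω → ω ∈ Ω → 𝟙 (bad ω) * (t * t) ≤ c * c * (D ω * D ω)
  pointwise ω ω∈ with bad ω in eq
  ... | false = z≤n
  ... | true  = begin
    1 * (t * t)             ≡⟨ *-identityˡ (t * t) ⟩
    t * t                   ≤⟨ *-mono-≤ (deviates ω ω∈ eq) (deviates ω ω∈ eq) ⟩
    c * D ω * (c * D ω)     ≡⟨ [m*n]*[o*p]≡[m*o]*[n*p] c (D ω) c (D ω) ⟩
    c * c * (D ω * D ω)     ∎
  expand : ∑[ ω ∈ Ω ] (D ω * D ω) + 2 * ∣Ω∣ * S * S ≡ ∣Ω∣ * (∣Ω∣ * S₂) + ∣Ω∣ * (S * S)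
  expand = begin-equality
    ∑[ ω ∈ Ω ] (D ω * D ω) + 2 * ∣Ω∣ * S * S
      ≡⟨ cong (∑[ ω ∈ Ω ] (D ω * D ω) +_) (sym (∑-*ˡ Ω (2 * ∣Ω∣ * S) f)) ⟩
    ∑[ ω ∈ Ω ] (D ω * D ω) + ∑[ ω ∈ Ω ] (2 * ∣Ω∣ * S * f ω)
      ≡⟨ sym (∑-distrib-+ Ω _ _) ⟩
    ∑[ ω ∈ Ω ] (D ω * D ω + 2 * ∣Ω∣ * S * f ω)
      ≡⟨ ∑-cong Ω (λ ω _ → trans (cong (D ω * D ω +_) (e₂ ∣Ω∣ S (f ω)))
           (trans (∣-∣-square (∣Ω∣ * f ω) S) (cong (_+ S * S) ([m*n]*[o*p]≡[m*o]*[n*p] ∣Ω∣ (f ω) ∣Ω∣ (f ω))))) ⟩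
    ∑[ ω ∈ Ω ] (∣Ω∣ * ∣Ω∣ * (f ω * f ω) + S * S)
      ≡⟨ ∑-distrib-+ Ω _ _ ⟩
    ∑[ ω ∈ Ω ] (∣Ω∣ * ∣Ω∣ * (f ω * f ω)) + ∑[ ω ∈ Ω ] (S * S)
      ≡⟨ cong₂ _+_ (trans (∑-*ˡ Ω (∣Ω∣ * ∣Ω∣) _) (*-assoc ∣Ω∣ ∣Ω∣ S₂)) (∑-const Ω (S * S)) ⟩
    ∣Ω∣ * (∣Ω∣ * S₂) + ∣Ω∣ * (S * S) ∎
    where
    e₂ : ∀ a b c → 2 * a * b * c ≡ 2 * (a * c * b)
    e₂ = solve-∀
  variance : ∑[ ω ∈ Ω ] (D ω * D ω) ≤ ∣Ω∣ * ∣Ω∣ * R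
  variance = +-cancelʳ-≤ (2 * ∣Ω∣ * S * S) _ _ (begin
    ∑[ ω ∈ Ω ] (D ω * D ω) + 2 * ∣Ω∣ * S * S ≡⟨ expand ⟩
    ∣Ω∣ * (∣Ω∣ * S₂) + ∣Ω∣ * (S * S)             ≤⟨ +-monoˡ-≤ (∣Ω∣ * (S * S)) (*-monoʳ-≤ ∣Ω∣ secondMoment) ⟩
    ∣Ω∣ * (S * S + ∣Ω∣ * R) + ∣Ω∣ * (S * S)      ≡⟨ e₃ ∣Ω∣ S R ⟩
    ∣Ω∣ * ∣Ω∣ * R + 2 * ∣Ω∣ * S * S              ∎)
    where
    e₃ : ∀ T S R → T * (S * S + T * R) + T * (S * S) ≡ T * T * R + 2 * T * S * S
    e₃ = solve-∀

-- Early sets in a random ordering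

clear≤1 : (χ : A → Bool) (m : ℕ) (σ : List A) → clear χ m σ ≤ 1
clear≤1 χ m       []      = ≤-refl
clear≤1 χ zero    (x ∷ σ) = *-mono-≤ (𝟙≤1 (not (χ x))) (clear≤1 χ zero σ)
clear≤1 χ (suc m) (x ∷ σ) = clear≤1 χ m σ

clear-*-≤ : {χ ψ φ : A → Bool} → (∀ x → φ x ≡ true → χ x ≡ true ⊎ ψ x ≡ true) →
  ∀ m σ → clear χ m σ * clear ψ m σ ≤ clear φ m σ
clear-*-≤ cover m       []      = ≤-refl
clear-*-≤ cover (suc m) (x ∷ σ) = clear-*-≤ cover m σ
clear-*-≤ {χ = χ} {ψ} {φ} cover zero (x ∷ σ) = begin
  𝟙 (not (χ x)) * clear χ 0 σ * (𝟙 (not (ψ x)) * clear ψ 0 σ)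
    ≡⟨ [m*n]*[o*p]≡[m*o]*[n*p] (𝟙 (not (χ x))) _ _ _ ⟩
  𝟙 (not (χ x)) * 𝟙 (not (ψ x)) * (clear χ 0 σ * clear ψ 0 σ)
    ≤⟨ *-mono-≤ head (clear-*-≤ cover 0 σ) ⟩
  𝟙 (not (φ x)) * clear φ 0 σ ∎
  where
  open ≤-Reasoning
  head : 𝟙 (not (χ x)) * 𝟙 (not (ψ x)) ≤ 𝟙 (not (φ x))
  head with φ x | cover x
  ... | false | _ = *-mono-≤ (𝟙≤1 (not (χ x))) (𝟙≤1 (not (ψ x)))
  ... | true  | c with c refl
  ...   | inj₁ e rewrite e = z≤n
  ...   | inj₂ e rewrite e = ≤-reflexive (*-zeroʳ (𝟙 (not (χ x))))

clear⇒∈take : {χ : A → Bool} (m : ℕ) {σ : List A} {e : A} →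
  1 ≤ clear χ m σ → χ e ≡ true → e ∈ σ → e ∈ take m σ
clear⇒∈take (suc m) 1≤ χe (here refl) = here refl
clear⇒∈take (suc m) {x ∷ σ} 1≤ χe (there e∈)  = there (clear⇒∈take m 1≤ χe e∈)
clear⇒∈take zero 1≤ χe (here refl) rewrite χe with () ← 1≤
clear⇒∈take {χ = χ} zero {x ∷ σ} 1≤ χe (there e∈) =
  contradiction (clear⇒∈take {χ = χ} zero (tail (𝟙 (not (χ x))) 1≤) χe e∈) λ ()
  where
  tail : ∀ a {b} → 1 ≤ a * b → 1 ≤ b
  tail a {zero}  1≤ = ≤-trans 1≤ (≤-reflexive (*-zeroʳ a))
  tail a {suc b} 1≤ = s≤s z≤n

clear-drop : {χ : A → Bool} (m : ℕ) (σ : List A) →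
  (∀ e → e ∈ drop m σ → χ e ≡ false) → clear χ m σ ≡ 1
clear-drop m       []      none = refl
clear-drop (suc m) (x ∷ σ) none = clear-drop m σ none
clear-drop {χ = χ} zero (x ∷ σ) none rewrite none x (here refl) =
  trans (+-identityʳ _) (clear-drop {χ = χ} zero σ (λ e e∈ → none e (there e∈)))

module Placement {E : Set} (_≟_ : DecidableEquality E) (xs : List E) (m : ℕ) (m≤N : m ≤ length xs) where

  open DecMembership _≟_ using (_∈?_)

  mult : E → List E → ℕ
  mult e ys = ∑[ x ∈ ys ] 𝟙 (does (x ≟ e))

  N Total : ℕ
  N = length xs
  Total = length (perms xs)

  early : List E → List E → ℕ
  early K σ = clear (λ e → does (e ∈? K)) m σ

  -- Number of orderings with k given elements among the first m.
  placements : ℕ → ℕ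
  placements k = falling m k * (N ∸ k) !

  -- Together the two conditions make the number of entries of `xs` that lie in K equal to
  -- `length K`, which is the k of the counting formula.
  Simple : List E → Set
  Simple K = Unique K × All (λ e → mult e xs ≡ 1) K

  count-Simple : ∀ K → Simple K → ∑[ x ∈ xs ] 𝟙 (does (x ∈? K)) ≡ length K
  count-Simple [] _ = trans (∑-const xs 0) (*-zeroʳ N)
  count-Simple (k ∷ K) (k∉ ∷ uniq , mk ∷ mK) = begin
    ∑[ x ∈ xs ] 𝟙 (does (x ∈? (k ∷ K)))
      ≡⟨ ∑-cong xs (λ x _ → split x) ⟩
    ∑[ x ∈ xs ] (𝟙 (does (x ≟ k)) + 𝟙 (does (x ∈? K)))
      ≡⟨ ∑-distrib-+ xs _ _ ⟩
    mult k xs + ∑[ x ∈ xs ] 𝟙 (does (x ∈? K))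
      ≡⟨ cong₂ _+_ mk (count-Simple K (uniq , mK)) ⟩
    suc (length K) ∎
    where
    open ≡-Reasoning
    split : ∀ x → 𝟙 (does (x ∈? (k ∷ K))) ≡ 𝟙 (does (x ≟ k)) + 𝟙 (does (x ∈? K))
    split x with x ≟ k
    ... | no _     = refl
    ... | yes refl = cong (λ b → suc (𝟙 b)) (sym (dec-false (k ∈? K) λ k∈ → All.lookup k∉ k∈ refl))

  length-Simple≤N : ∀ K → Simple K → length K ≤ N
  length-Simple≤N K simple = begin
    length K                          ≡⟨ sym (count-Simple K simple) ⟩
    ∑[ x ∈ xs ] 𝟙 (does (x ∈? K))     ≤⟨ ∑-mono xs (λ x _ → 𝟙≤1 (does (x ∈? K))) ⟩
    ∑[ _ ∈ xs ] 1                     ≡⟨ sym (length-∑ xs) ⟩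
    N                                 ∎
    where open ≤-Reasoning

  ∑-early : ∀ K → Simple K → ∑ (perms xs) (early K) ≡ placements (length K)
  ∑-early K simple = ∑-perms-clear _ xs m (N ∸ m) (length K) (N ∸ length K)
    (sym (m+[n∸m]≡n m≤N)) (count-Simple K simple)
    (trans (m+[n∸m]≡n (length-Simple≤N K simple)) (sym (m+[n∸m]≡n m≤N)))

  -- The empty set is early in every ordering, so this is the counting formula for k = 0.
  Total≡N! : Total ≡ N !
  Total≡N! = begin
    Total                          ≡⟨ length-∑ (perms xs) ⟩
    ∑[ _ ∈ perms xs ] 1        ≡⟨ ∑-cong (perms xs) (λ σ _ → sym (clear-drop m σ (λ _ _ → refl))) ⟩
    ∑ (perms xs) (early [])    ≡⟨ ∑-early [] ([] , []) ⟩
    1 * N !                    ≡⟨ *-identityˡ (N !) ⟩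
    N !                        ∎
    where open ≡-Reasoning

  early-*-≤ : ∀ K L M → M ⊆ K ++ L → ∀ σ → early K σ * early L σ ≤ early M σ
  early-*-≤ K L M M⊆ = clear-*-≤ cover m
    where
    cover : ∀ x → does (x ∈? M) ≡ true → does (x ∈? K) ≡ true ⊎ does (x ∈? L) ≡ true
    cover x _  with x ∈? M
    cover x () | no _
    cover x _  | yes x∈ with ∈-++⁻ K (M⊆ x∈)
    ... | inj₁ x∈K = inj₁ (dec-true (x ∈? K) x∈K)
    ... | inj₂ x∈L = inj₂ (dec-true (x ∈? L) x∈L)

  placements-submultiplicative : ∀ k₁ k₂ → k₁ + k₂ ≤ N →
    Total * placements (k₁ + k₂) ≤ placements k₁ * placements k₂
  placements-submultiplicative k₁ k₂ k≤N = begin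
    Total * placements (k₁ + k₂)                                ≡⟨ *-comm Total _ ⟩
    falling m (k₁ + k₂) * l ! * Total                           ≡⟨ cong (falling m (k₁ + k₂) * l ! *_) (trans Total≡N! (cong _! (sym l+k))) ⟩
    falling m (k₁ + k₂) * l ! * (l + (k₁ + k₂)) !           ≤⟨ falling-submultiplicative m k₁ k₂ l (≤-trans m≤N (≤-reflexive (sym l+k))) ⟩
    falling m k₁ * (l + k₂) ! * (falling m k₂ * (l + k₁) !) ≡⟨ cong₂ (λ a b → falling m k₁ * a ! * (falling m k₂ * b !)) l+k₂ l+k₁ ⟩
    placements k₁ * placements k₂                           ∎
    where
    open ≤-Reasoning
    l = N ∸ (k₁ + k₂)
    l+k : l + (k₁ + k₂) ≡ N
    l+k = m∸n+n≡m k≤N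
    l+k₂ : l + k₂ ≡ N ∸ k₁
    l+k₂ = sym (trans (cong (_∸ k₁) (sym (trans (e l k₁ k₂) l+k))) (m+n∸n≡m (l + k₂) k₁))
      where
      e : ∀ l a b → l + b + a ≡ l + (a + b)
      e = solve-∀
    l+k₁ : l + k₁ ≡ N ∸ k₂
    l+k₁ = sym (trans (cong (_∸ k₂) (sym (trans (+-assoc l k₁ k₂) l+k))) (m+n∸n≡m (l + k₁) k₂))

  placements-power : ∀ r .{{_ : NonZero r}} k → k ≤ N → m * r ≤ N → placements k * r ^ k ≤ Total
  placements-power r k k≤N mr≤N = ≤-trans
    (falling-power m r k (N ∸ k) (≤-trans mr≤N (≤-reflexive (sym (m+[n∸m]≡n k≤N)))))
    (≤-reflexive (trans (cong _! (m+[n∸m]≡n k≤N)) (sym Total≡N!)))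

  -- A single element is early with probability exactly m / N. The mean of Y must be bounded from
  -- below, for which the upper bounds by powers of 1 / r are of no help.
  placements₁ : 1 ≤ N → N * placements 1 ≡ m * Total
  placements₁ 1≤N = begin
    N * (falling m 1 * (N ∸ 1) !)   ≡⟨ cong (λ z → N * (z * (N ∸ 1) !)) (trans (sym (falling-pred m 0)) (*-identityʳ m)) ⟩
    N * (m * (N ∸ 1) !)             ≡⟨ e N m ((N ∸ 1) !) ⟩
    m * (N * (N ∸ 1) !)             ≡⟨ cong (m *_) (trans (fact N 1≤N) (sym Total≡N!)) ⟩
    m * Total                           ∎
    where
    open ≡-Reasoning
    e : ∀ a b c → a * (b * c) ≡ b * (a * c)
    e = solve-∀
    fact : ∀ n → 1 ≤ n → n * (n ∸ 1) ! ≡ n !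
    fact (suc n) _ = refl

  -- Here `w i j` divided by `Total` bounds the covariance of the events that `K i` and `K j` are
  -- early, and `R` divided by `Total` bounds the variance of their number. The set M replaces the
  -- concatenation of `K i` and `K j`, which may repeat elements, by a duplicate-free list contained
  -- in it.
  module Family {I : Set} (is : List I) (K : I → List E) (w : I → I → ℕ)
    (simple : ∀ i → i ∈ is → Simple (K i))
    (pair : ∀ i j → i ∈ is → j ∈ is → ∃[ M ] Simple M × M ⊆ K i ++ K j ×
      Total * placements (length M) ≤ placements (length (K i)) * placements (length (K j)) + Total * w i j)
    where

    count : List E → ℕ
    count σ = ∑[ i ∈ is ] early (K i) σ

    R : ℕ
    R = ∑[ i ∈ is ] ∑[ j ∈ is ] w i j

    ∑-count : ∑ (perms xs) count ≡ ∑[ i ∈ is ] placements (length (K i))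
    ∑-count = trans (∑-swap (perms xs) is _) (∑-cong is (λ i i∈ → ∑-early (K i) (simple i i∈)))

    secondMoment : Total * ∑[ σ ∈ perms xs ] (count σ * count σ)
                   ≤ ∑ (perms xs) count * ∑ (perms xs) count + Total * R
    secondMoment = begin
      Total * ∑[ σ ∈ perms xs ] (count σ * count σ)
        ≡⟨ cong (Total *_) (∑-cong (perms xs) (λ σ _ → sym (∑-*-∑ is is _ _))) ⟩
      Total * ∑[ σ ∈ perms xs ] ∑[ i ∈ is ] ∑[ j ∈ is ] (early (K i) σ * early (K j) σ)
        ≡⟨ cong (Total *_) (trans (∑-swap (perms xs) is _) (∑-cong is (λ i _ → ∑-swap (perms xs) is _))) ⟩
      Total * ∑[ i ∈ is ] ∑[ j ∈ is ] ∑[ σ ∈ perms xs ] (early (K i) σ * early (K j) σ)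
        ≡⟨ sym (trans (∑-cong is (λ i _ → ∑-*ˡ is Total _)) (∑-*ˡ is Total _)) ⟩
      ∑[ i ∈ is ] ∑[ j ∈ is ] (Total * ∑[ σ ∈ perms xs ] (early (K i) σ * early (K j) σ))
        ≤⟨ ∑-mono is (λ i i∈ → ∑-mono is (λ j j∈ → pairwise i j i∈ j∈)) ⟩
      ∑[ i ∈ is ] ∑[ j ∈ is ] (p i * p j + Total * w i j)
        ≡⟨ trans (∑-cong is (λ i _ → ∑-distrib-+ is _ _)) (∑-distrib-+ is _ _) ⟩
      ∑[ i ∈ is ] ∑[ j ∈ is ] (p i * p j) + ∑[ i ∈ is ] ∑[ j ∈ is ] (Total * w i j)
        ≡⟨ cong₂ _+_ (trans (∑-*-∑ is is p p) (sym (cong₂ _*_ ∑-count ∑-count)))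
             (trans (∑-cong is (λ i _ → ∑-*ˡ is Total _)) (∑-*ˡ is Total _)) ⟩
      ∑ (perms xs) count * ∑ (perms xs) count + Total * R ∎
      where
      open ≤-Reasoning
      p : I → ℕ
      p i = placements (length (K i))
      pairwise : ∀ i j → i ∈ is → j ∈ is →
        Total * ∑[ σ ∈ perms xs ] (early (K i) σ * early (K j) σ) ≤ p i * p j + Total * w i j
      pairwise i j i∈ j∈ with pair i j i∈ j∈
      ... | M , simpleM , M⊆ , bound = ≤-trans
        (*-monoʳ-≤ Total (≤-trans (∑-mono (perms xs) (λ σ _ → early-*-≤ (K i) (K j) M M⊆ σ))
                              (≤-reflexive (∑-early M simpleM)))) bound

    -- The variance is at most C d / (c² r) and a bad ordering deviates by at least d / (c r), so
    -- Chebyshev's quotient is C r / d.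
    deviation : (bad : List E → Bool) (c C d r : ℕ) .{{_ : NonZero d}} →
      c * c * r * R ≤ C * (d * Total) →
      (∀ σ → σ ∈ perms xs → bad σ ≡ true → d * Total ≤ c * r * ∣ Total * count σ - ∑ (perms xs) count ∣) →
      ∑[ σ ∈ perms xs ] 𝟙 (bad σ) * d ≤ C * r * Total
    deviation bad c C d r R≤ deviates =
      *-cancelʳ-≤ _ _ (d * Total * Total) {{m*n≢0 (d * Total) Total {{m*n≢0 d Total}}}} (begin
        b * d * (d * Total * Total)               ≡⟨ e₁ b d Total ⟩
        b * (d * Total * (d * Total))             ≤⟨ chebyshev (perms xs) count bad (c * r) (d * Total) R secondMoment deviates ⟩
        c * r * (c * r) * (Total * Total * R)     ≡⟨ e₂ c r Total R ⟩
        r * (Total * Total) * (c * c * r * R)     ≤⟨ *-monoʳ-≤ (r * (Total * Total)) R≤ ⟩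
        r * (Total * Total) * (C * (d * Total))       ≡⟨ e₃ r Total C d ⟩
        C * r * Total * (d * Total * Total)           ∎)
      where
      open ≤-Reasoning
      b = ∑[ σ ∈ perms xs ] 𝟙 (bad σ)
      instance
        Total≢0 : NonZero Total
        Total≢0 = subst NonZero (sym Total≡N!) (N !≢0)
      e₁ : ∀ b d T → b * d * (d * T * T) ≡ b * (d * T * (d * T))
      e₁ = solve-∀
      e₂ : ∀ c r T R → c * r * (c * r) * (T * T * R) ≡ r * (T * T) * (c * c * r * R)
      e₂ = solve-∀
      e₃ : ∀ r T C d → r * (T * T) * (C * (d * T)) ≡ C * r * T * (d * T * T)
      e₃ = solve-∀

-- Squares in a grid of elements

≤ᵇ-true : ∀ a b → (a ≤ᵇ b) ≡ true → a ≤ b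
≤ᵇ-true a b eq = ≤ᵇ⇒≤ a b (Equivalence.from T-≡ eq)

∑-δ : (_≟_ : DecidableEquality A) {xs : List A} {x : A} → Unique xs → x ∈ xs →
      ∑[ y ∈ xs ] 𝟙 (does (y ≟ x)) ≡ 1
∑-δ _≟_ {y ∷ ys} {x} (y∉ ∷ uniq) x∈ with y ≟ x | x∈
... | no y≢x   | here x≡y  = contradiction (sym x≡y) y≢x
... | no _     | there x∈′ = ∑-δ _≟_ uniq x∈′
... | yes refl | _ = cong suc (trans (∑-cong ys (λ z z∈ → cong 𝟙 (dec-false (z ≟ x) (≢-sym (All.lookup y∉ z∈)))))
                                     (trans (∑-const ys 0) (*-zeroʳ (length ys))))

∑-allFin-δ : ∀ {d} (i : Fin d) → ∑[ j ∈ allFin d ] 𝟙 (does (j Fin.≟ i)) ≡ 1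
∑-allFin-δ {d} i = ∑-δ Fin._≟_ (Unique.allFin⁺ d) (∈-allFin i)

∑-allFin-const : ∀ d c → ∑[ _ ∈ allFin d ] c ≡ d * c
∑-allFin-const d c = trans (∑-const (allFin d) c) (cong (_* c) (length-tabulate (id {A = Fin d})))

falling-zero : ∀ {m k} → m < k → falling m k ≡ 0
falling-zero {zero}  {suc k} _         = refl
falling-zero {suc m} {suc k} (s≤s m<k) = trans (cong (suc m *_) (falling-zero m<k)) (*-zeroʳ m)

offDiagonal : ∀ d → List (Fin d × Fin d)
offDiagonal d = filter (λ p → ¬? (proj₁ p Fin.≟ proj₂ p)) (cartesianProduct (allFin d) (allFin d))

∈-offDiagonal⁺ : ∀ {d} {i j : Fin d} → i ≢ j → (i , j) ∈ offDiagonal d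
∈-offDiagonal⁺ i≢j = ∈-filter⁺ _ (∈-cartesianProduct⁺ (∈-allFin _) (∈-allFin _)) i≢j

∈-offDiagonal⁻ : ∀ {d} {p : Fin d × Fin d} → p ∈ offDiagonal d → proj₁ p ≢ proj₂ p
∈-offDiagonal⁻ {d} p∈ = proj₂ (∈-filter⁻ (λ p → ¬? (proj₁ p Fin.≟ proj₂ p)) {xs = cartesianProduct (allFin d) (allFin d)} p∈)

∑-offDiagonal≤ : ∀ d (f : Fin d × Fin d → ℕ) →
  ∑ (offDiagonal d) f ≤ ∑[ i ∈ allFin d ] ∑[ j ∈ allFin d ] f (i , j)
∑-offDiagonal≤ d f = ≤-trans (∑-filter≤ _ (cartesianProduct (allFin d) (allFin d)) f)
                             (≤-reflexive (∑-cartesianProduct (allFin d) (allFin d) f))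

-- Models a 4-cycle by a product of index sets: the sets {i,j}² and {k,l}² meet in ({i,j} ∩ {k,l})²,
-- so the overlap of two 4-cycles can be read off from their common indices.
square : ∀ {d} → Fin d → Fin d → List (Fin d × Fin d)
square i j = cartesianProduct (i ∷ j ∷ []) (i ∷ j ∷ [])

Unique₂ : {a b : A} → a ≢ b → Unique (a ∷ b ∷ [])
Unique₂ a≢b = (a≢b ∷ []) ∷ [] ∷ []

square-unique : ∀ {d} {i j : Fin d} → i ≢ j → Unique (square i j)
square-unique i≢j = Unique.cartesianProduct⁺ (Unique₂ i≢j) (Unique₂ i≢j)

∈₂ : {x a b : A} → x ∈ a ∷ b ∷ [] → x ≡ a ⊎ x ≡ b
∈₂ (here eq)         = inj₁ eq
∈₂ (there (here eq)) = inj₂ eq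

∉₂ : {x a b : A} → x ≢ a → x ≢ b → x ∉ a ∷ b ∷ []
∉₂ x≢a x≢b x∈ with ∈₂ x∈
... | inj₁ eq = x≢a eq
... | inj₂ eq = x≢b eq

-- The seven elements of {a,b}² ∪ {a,c}², with the common pair `(a , a)` listed once.
squares-union : ∀ {d} → Fin d → Fin d → Fin d → List (Fin d × Fin d)
squares-union a b c = square a b ++ (c , c) ∷ (a , c) ∷ (c , a) ∷ []

squares-union-unique : ∀ {d} {a b c : Fin d} → a ≢ b → a ≢ c → b ≢ c → Unique (squares-union a b c)
squares-union-unique {a = a} {b} {c} a≢b a≢c b≢c =
  Unique.++⁺ (square-unique a≢b)
    (((a≢c ∘ sym ∘ cong proj₁) ∷ (a≢c ∘ sym ∘ cong proj₂) ∷ []) ∷ ((a≢c ∘ cong proj₁) ∷ []) ∷ [] ∷ [])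
    λ { (x∈ , here refl)                 → c∉ (proj₁ (split x∈))
      ; (x∈ , there (here refl))         → c∉ (proj₂ (split x∈))
      ; (x∈ , there (there (here refl))) → c∉ (proj₁ (split x∈)) }
  where
  c∉ = ∉₂ (≢-sym a≢c) (≢-sym b≢c)
  split : ∀ {x y} → (x , y) ∈ square a b → x ∈ a ∷ b ∷ [] × y ∈ a ∷ b ∷ []
  split = ∈-cartesianProduct⁻ (a ∷ b ∷ []) (a ∷ b ∷ [])

squares-union-⊆ : ∀ {d} {a b c i j k l : Fin d} →
  a ∈ i ∷ j ∷ [] → b ∈ i ∷ j ∷ [] → a ∈ k ∷ l ∷ [] → c ∈ k ∷ l ∷ [] →
  squares-union a b c ⊆ square i j ++ square k l
squares-union-⊆ {a = a} {b} {c} {i} {j} {k} {l} a∈ b∈ a∈′ c∈′ x∈ with ∈-++⁻ (square a b) x∈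
... | inj₁ x∈ab with ∈-cartesianProduct⁻ (a ∷ b ∷ []) (a ∷ b ∷ []) x∈ab
...   | p , q = ∈-++⁺ˡ (∈-cartesianProduct⁺ (pick p) (pick q))
  where
  pick : ∀ {x} → x ∈ a ∷ b ∷ [] → x ∈ i ∷ j ∷ []
  pick (here refl)         = a∈
  pick (there (here refl)) = b∈
squares-union-⊆ {i = i} {j} a∈ b∈ a∈′ c∈′ x∈ | inj₂ (here refl) =
  ∈-++⁺ʳ (square i j) (∈-cartesianProduct⁺ c∈′ c∈′)
squares-union-⊆ {i = i} {j} a∈ b∈ a∈′ c∈′ x∈ | inj₂ (there (here refl)) =
  ∈-++⁺ʳ (square i j) (∈-cartesianProduct⁺ a∈′ c∈′)
squares-union-⊆ {i = i} {j} a∈ b∈ a∈′ c∈′ x∈ | inj₂ (there (there (here refl))) =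
  ∈-++⁺ʳ (square i j) (∈-cartesianProduct⁺ c∈′ a∈′)

-- The moment estimates need nothing about the cube beyond d² distinct elements, each occurring
-- exactly once in `xs`.
module Grid {E : Set} (_≟_ : DecidableEquality E) (xs : List E) (m : ℕ) (m≤N : m ≤ length xs)
  {d : ℕ} (ι : Fin d × Fin d → E) (ι-injective : ∀ {p q} → ι p ≡ ι q → p ≡ q)
  (ι-mult : ∀ p → ∑[ x ∈ xs ] 𝟙 (does (x ≟ ι p)) ≡ 1) where

  open Placement _≟_ xs m m≤N

  simple-keys : ∀ {ps} → Unique ps → Simple (map ι ps)
  simple-keys {ps} uniq = Unique.map⁺ ι-injective uniq , All.tabulate mult-one
    where
    mult-one : ∀ {e} → e ∈ map ι ps → mult e xs ≡ 1
    mult-one e∈ with ∈-map⁻ ι e∈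
    ... | p , _ , refl = ι-mult p

  map-⊆ : ∀ ps qs qs′ → ps ⊆ qs ++ qs′ → map ι ps ⊆ map ι qs ++ map ι qs′
  map-⊆ ps qs qs′ ps⊆ {x} x∈ = subst (x ∈_) (map-++ ι qs qs′) (Subset.map⁺ ι ps⊆ x∈)

  -- The variable Y. Distinct single elements are negatively correlated, so only the terms i = j
  -- contribute to the variance bound, which is then the mean itself.
  module Diagonal where

    K : Fin d → List E
    K i = map ι ((i , i) ∷ [])

    w : Fin d → Fin d → ℕ
    w i j = 𝟙 (does (j Fin.≟ i)) * placements 1

    pair : ∀ i j → i ∈ allFin d → j ∈ allFin d → ∃[ M ] Simple M × M ⊆ K i ++ K j ×
      Total * placements (length M) ≤ placements 1 * placements 1 + Total * w i j
    pair i j _ _ with j Fin.≟ i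
    ... | yes refl = K i , simple-keys ([] ∷ []) , ∈-++⁺ˡ ,
          ≤-trans (*-monoʳ-≤ Total (≤-reflexive (sym (*-identityˡ _)))) (m≤n+m _ (placements 1 * placements 1))
    ... | no j≢i = K i ++ K j , simple , id ,
          ≤-trans (placements-submultiplicative 1 1 (length-Simple≤N (K i ++ K j) simple)) (m≤m+n _ _)
      where
      simple : Simple (K i ++ K j)
      simple = simple-keys (((j≢i ∘ sym ∘ cong proj₁) ∷ []) ∷ [] ∷ [])

    open Family (allFin d) K w (λ i _ → simple-keys ([] ∷ [])) pair public

    R≡ : R ≡ d * placements 1
    R≡ = trans (∑-cong (allFin d) (λ i _ → trans (∑-*ʳ (allFin d) (placements 1) _)
                 (trans (cong (_* placements 1) (∑-allFin-δ i)) (*-identityˡ _))))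
               (∑-allFin-const d (placements 1))

  -- The variable X. Only pairs of squares with a common index contribute to the variance bound.
  module OffDiagonal where

    K : Fin d × Fin d → List E
    K (i , j) = map ι (square i j)

    -- {i,j}² ∪ {k,l}² has 4 elements if {i,j} = {k,l} and 7 if the two pairs share one index;
    -- ki stands for k ≡ i, and so on.
    weight : Bool → Bool → Bool → Bool → ℕ
    weight ki kj li lj = (𝟙 ki * 𝟙 lj + 𝟙 kj * 𝟙 li) * placements 4
                       + (𝟙 ki + 𝟙 kj + (𝟙 li + 𝟙 lj)) * placements 7

    w : Fin d × Fin d → Fin d × Fin d → ℕ
    w (i , j) (k , l) = weight (does (k Fin.≟ i)) (does (k Fin.≟ j)) (does (l Fin.≟ i)) (does (l Fin.≟ j))

    module _ {i j k l : Fin d} (i≢j : i ≢ j) (k≢l : k ≢ l) where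

      Bounded : ℕ → Set
      Bounded v = ∃[ M ] Simple M × M ⊆ K (i , j) ++ K (k , l) ×
        Total * placements (length M) ≤ placements 4 * placements 4 + Total * v

      -- For overlapping squares the product of the two probabilities is given away, and the whole
      -- probability of the union is charged to the weight.
      dependent : ∀ {v} ps → Unique ps → ps ⊆ square i j ++ square k l →
                  placements (length (map ι ps)) ≤ v → Bounded v
      dependent ps uniq ps⊆ ≤v = map ι ps , simple-keys uniq , map-⊆ ps (square i j) (square k l) ps⊆ ,
        ≤-trans (*-monoʳ-≤ Total ≤v) (m≤n+m _ (placements 4 * placements 4))

      same : ∀ {v} → placements 4 ≤ v → Bounded v
      same = dependent (square i j) (square-unique i≢j) ∈-++⁺ˡ

      overlapping : ∀ {v} a b c → a ≢ b → a ≢ c → b ≢ c →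
        a ∈ i ∷ j ∷ [] → b ∈ i ∷ j ∷ [] → a ∈ k ∷ l ∷ [] → c ∈ k ∷ l ∷ [] → placements 7 ≤ v → Bounded v
      overlapping a b c a≢b a≢c b≢c a∈ b∈ a∈′ c∈′ =
        dependent (squares-union a b c) (squares-union-unique a≢b a≢c b≢c) (squares-union-⊆ a∈ b∈ a∈′ c∈′)

      -- The four decisions are arguments, so that matching on them evaluates the weight.
      cases : (ki : Dec (k ≡ i)) (kj : Dec (k ≡ j)) (li : Dec (l ≡ i)) (lj : Dec (l ≡ j)) →
              Bounded (weight (does ki) (does kj) (does li) (does lj))
      cases (yes refl) (yes k≡j) _ _ = contradiction k≡j i≢j
      cases (yes refl) (no _) (yes l≡i) _ = contradiction (sym l≡i) k≢l
      cases (yes refl) (no _) (no _) (yes refl) = same (≤-trans (m≤m+n (placements 4) _) (m≤m+n _ _))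
      cases (yes refl) (no _) (no l≢i) (no l≢j) =
        overlapping i j l i≢j (≢-sym l≢i) (≢-sym l≢j) (here refl) (there (here refl)) (here refl) (there (here refl))
          (m≤m+n (placements 7) _)
      cases (no _) (yes refl) _ (yes l≡j) = contradiction (sym l≡j) k≢l
      cases (no _) (yes refl) (yes refl) (no _) = same (≤-trans (m≤m+n (placements 4) _) (m≤m+n _ _))
      cases (no _) (yes refl) (no l≢i) (no l≢j) =
        overlapping j i l (≢-sym i≢j) (≢-sym l≢j) (≢-sym l≢i) (there (here refl)) (here refl) (here refl) (there (here refl))
          (m≤m+n (placements 7) _)
      cases (no _) (no _) (yes refl) (yes l≡j) = contradiction l≡j i≢j
      cases (no k≢i) (no k≢j) (yes refl) (no _) =
        overlapping i j k i≢j (≢-sym k≢i) (≢-sym k≢j) (here refl) (there (here refl)) (there (here refl)) (here refl)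
          (m≤m+n (placements 7) _)
      cases (no k≢i) (no k≢j) (no _) (yes refl) =
        overlapping j i k (≢-sym i≢j) (≢-sym k≢j) (≢-sym k≢i) (there (here refl)) (here refl) (there (here refl)) (here refl)
          (m≤m+n (placements 7) _)
      -- No common index: the squares are disjoint, the weight is zero, and negative correlation
      -- alone gives the bound.
      cases (no k≢i) (no k≢j) (no l≢i) (no l≢j) =
        map ι (square i j ++ square k l) , simple , map-⊆ (square i j ++ square k l) (square i j) (square k l) id ,
        ≤-trans (placements-submultiplicative 4 4 (length-Simple≤N _ simple)) (m≤m+n _ _)
        where
        disjoint : ∀ {p} → ¬ (p ∈ square i j × p ∈ square k l)
        disjoint (p∈ , p∈′) with ∈₂ (proj₁ (∈-cartesianProduct⁻ (k ∷ l ∷ []) (k ∷ l ∷ []) p∈′))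
                               | proj₁ (∈-cartesianProduct⁻ (i ∷ j ∷ []) (i ∷ j ∷ []) p∈)
        ... | inj₁ refl | x∈ = ∉₂ k≢i k≢j x∈
        ... | inj₂ refl | x∈ = ∉₂ l≢i l≢j x∈
        simple : Simple (map ι (square i j ++ square k l))
        simple = simple-keys (Unique.++⁺ (square-unique i≢j) (square-unique k≢l) disjoint)

    simple : ∀ p → p ∈ offDiagonal d → Simple (K p)
    simple p p∈ = simple-keys (square-unique (∈-offDiagonal⁻ p∈))

    pair : ∀ p q → p ∈ offDiagonal d → q ∈ offDiagonal d → ∃[ M ] Simple M × M ⊆ K p ++ K q ×
      Total * placements (length M) ≤ placements 4 * placements 4 + Total * w p q
    pair (i , j) (k , l) p∈ q∈ = cases (∈-offDiagonal⁻ p∈) (∈-offDiagonal⁻ q∈)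
      (k Fin.≟ i) (k Fin.≟ j) (l Fin.≟ i) (l Fin.≟ j)

    open Family (offDiagonal d) K w simple pair public

    -- The set {i,j} comes from two ordered pairs. A shared index arises in four ways, according to
    -- which entry equals which, each leaving at most d values for the other entry.
    ∑-w≤ : ∀ p → ∑[ q ∈ offDiagonal d ] w p q ≤ 2 * placements 4 + 4 * d * placements 7
    ∑-w≤ (i , j) = begin
      ∑[ q ∈ offDiagonal d ] w (i , j) q
        ≤⟨ ∑-offDiagonal≤ d (w (i , j)) ⟩
      ∑[ k ∈ Fs ] ∑[ l ∈ Fs ] ((δ i k * δ j l + δ j k * δ i l) * p₄ + (δ i k + δ j k + (δ i l + δ j l)) * p₇)
        ≡⟨ ∑-cong Fs (λ k _ → inner k) ⟩
      ∑[ k ∈ Fs ] ((δ i k + δ j k) * p₄ + (d * (δ i k + δ j k) + 2) * p₇)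
        ≡⟨ ∑-distrib-+ Fs _ _ ⟩
      ∑[ k ∈ Fs ] ((δ i k + δ j k) * p₄) + ∑[ k ∈ Fs ] ((d * (δ i k + δ j k) + 2) * p₇)
        ≡⟨ cong₂ _+_ (trans (∑-*ʳ Fs p₄ _) (cong (_* p₄) two))
             (trans (∑-*ʳ Fs p₇ _) (cong (_* p₇) (trans (∑-distrib-+ Fs _ _)
               (cong₂ _+_ (trans (∑-*ˡ Fs d _) (cong (d *_) two)) (∑-allFin-const d 2))))) ⟩
      2 * p₄ + (d * 2 + d * 2) * p₇
        ≡⟨ cong (λ z → 2 * p₄ + z * p₇) (e d) ⟩
      2 * p₄ + 4 * d * p₇ ∎
      where
      open ≤-Reasoning
      Fs = allFin d
      p₄ = placements 4
      p₇ = placements 7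
      δ : Fin d → Fin d → ℕ
      δ a b = 𝟙 (does (b Fin.≟ a))
      e : ∀ d → d * 2 + d * 2 ≡ 4 * d
      e = solve-∀
      two : ∑[ k ∈ Fs ] (δ i k + δ j k) ≡ 2
      two = trans (∑-distrib-+ Fs _ _) (cong₂ _+_ (∑-allFin-δ i) (∑-allFin-δ j))
      weighted : ∀ a b → ∑[ l ∈ Fs ] (a * δ j l + b * δ i l) ≡ a + b
      weighted a b = trans (∑-distrib-+ Fs _ _) (cong₂ _+_
        (trans (∑-*ˡ Fs a _) (trans (cong (a *_) (∑-allFin-δ j)) (*-identityʳ a)))
        (trans (∑-*ˡ Fs b _) (trans (cong (b *_) (∑-allFin-δ i)) (*-identityʳ b))))
      inner : ∀ k → ∑[ l ∈ Fs ] ((δ i k * δ j l + δ j k * δ i l) * p₄ + (δ i k + δ j k + (δ i l + δ j l)) * p₇)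
                    ≡ (δ i k + δ j k) * p₄ + (d * (δ i k + δ j k) + 2) * p₇
      inner k = trans (∑-distrib-+ Fs _ _) (cong₂ _+_
        (trans (∑-*ʳ Fs p₄ _) (cong (_* p₄) (weighted (δ i k) (δ j k))))
        (trans (∑-*ʳ Fs p₇ _) (cong (_* p₇) (trans (∑-distrib-+ Fs _ _) (cong₂ _+_
          (∑-allFin-const d (δ i k + δ j k)) two)))))

    R≤ : R ≤ d * d * (2 * placements 4 + 4 * d * placements 7)
    R≤ = begin
      R                                       ≤⟨ ∑-mono (offDiagonal d) (λ p _ → ∑-w≤ p) ⟩
      ∑[ _ ∈ offDiagonal d ] b                ≤⟨ ∑-offDiagonal≤ d (λ _ → b) ⟩
      ∑[ _ ∈ allFin d ] ∑[ _ ∈ allFin d ] b   ≡⟨ trans (∑-cong (allFin d) (λ _ _ → ∑-allFin-const d b)) (∑-allFin-const d (d * b)) ⟩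
      d * (d * b)                             ≡⟨ sym (*-assoc d d b) ⟩
      d * d * b                               ∎
      where
      open ≤-Reasoning
      b = 2 * placements 4 + 4 * d * placements 7

    ∑-count≤ : ∑ (perms xs) count ≤ d * d * placements 4
    ∑-count≤ = begin
      ∑ (perms xs) count                                   ≡⟨ ∑-count ⟩
      ∑[ _ ∈ offDiagonal d ] placements 4                  ≤⟨ ∑-offDiagonal≤ d (λ _ → placements 4) ⟩
      ∑[ _ ∈ allFin d ] ∑[ _ ∈ allFin d ] placements 4     ≡⟨ trans (∑-cong (allFin d) (λ _ _ → ∑-allFin-const d (placements 4))) (∑-allFin-const d (d * placements 4)) ⟩
      d * (d * placements 4)                               ≡⟨ sym (*-assoc d d (placements 4)) ⟩
      d * d * placements 4                                 ∎
      where open ≤-Reasoning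

  module Bounds (r : ℕ) .{{_ : NonZero r}} .{{_ : NonZero d}}
    (mr≤N : m * r ≤ N) (N≤2mr : N ≤ 2 * (m * r)) (1≤N : 1 ≤ N) (64d≤r³ : 64 * d ≤ r ^ 3) where

    open ≤-Reasoning

    power : ∀ k → placements k * r ^ k ≤ Total
    power k with k ≤? N
    ... | yes k≤N = placements-power r k k≤N mr≤N
    -- Here m ≤ N < k, so `falling m k` vanishes; thus k = 4 and k = 7 can be used without a lower
    -- bound on N.
    ... | no  k≰N = ≤-trans (≤-reflexive (cong (λ z → z * (N ∸ k) ! * r ^ k) (falling-zero (≤-<-trans m≤N (≰⇒> k≰N))))) z≤n

    -- The threshold d / (4 r) is half the lower bound on the mean. The variance is at most d / r,
    -- and (d / r) / (d / (4 r))² = 16 r / d.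
    few-early : ∑[ σ ∈ perms xs ] 𝟙 (4 * r * Diagonal.count σ ≤ᵇ d) * d ≤ 16 * r * Total
    few-early = Diagonal.deviation _ 4 16 d r R-bound deviates
      where
      p₁ = placements 1
      S = ∑ (perms xs) Diagonal.count
      S≡ : S ≡ d * p₁
      S≡ = trans Diagonal.∑-count (∑-allFin-const d p₁)
      e₁ : ∀ d p r → 4 * 4 * r * (d * p) ≡ 16 * (d * (p * (r * 1)))
      e₁ = solve-∀
      R-bound : 4 * 4 * r * Diagonal.R ≤ 16 * (d * Total)
      R-bound = begin
        4 * 4 * r * Diagonal.R  ≡⟨ cong (4 * 4 * r *_) Diagonal.R≡ ⟩
        4 * 4 * r * (d * p₁)    ≡⟨ e₁ d p₁ r ⟩
        16 * (d * (p₁ * r ^ 1)) ≤⟨ *-monoʳ-≤ 16 (*-monoʳ-≤ d (power 1)) ⟩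
        16 * (d * Total)        ∎
      e₂ : ∀ m r T → 2 * (m * r) * T ≡ (m * T) * (2 * r)
      e₂ = solve-∀
      e₃ : ∀ N p r → N * p * (2 * r) ≡ N * (2 * r * p)
      e₃ = solve-∀
      Total≤ : Total ≤ 2 * r * p₁
      Total≤ = *-cancelˡ-≤ N {{>-nonZero 1≤N}} (begin
        N * Total               ≤⟨ *-monoˡ-≤ Total N≤2mr ⟩
        2 * (m * r) * Total     ≡⟨ e₂ m r Total ⟩
        m * Total * (2 * r)     ≡⟨ cong (_* (2 * r)) (sym (placements₁ 1≤N)) ⟩
        N * p₁ * (2 * r)        ≡⟨ e₃ N p₁ r ⟩
        N * (2 * r * p₁)        ∎)
      e₄ : ∀ d r p → 2 * d * (2 * r * p) ≡ 4 * r * (d * p)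
      e₄ = solve-∀
      e₅ : ∀ r T Y D → 4 * r * (T * Y + D) ≡ 4 * r * Y * T + 4 * r * D
      e₅ = solve-∀
      e₆ : ∀ d T → d * T + d * T ≡ 2 * d * T
      e₆ = solve-∀
      deviates : ∀ σ → σ ∈ perms xs → (4 * r * Diagonal.count σ ≤ᵇ d) ≡ true →
        d * Total ≤ 4 * r * ∣ Total * Diagonal.count σ - S ∣
      deviates σ _ bad = +-cancelˡ-≤ (d * Total) _ _ (begin
        d * Total + d * Total          ≡⟨ e₆ d Total ⟩
        2 * d * Total                  ≤⟨ *-monoʳ-≤ (2 * d) Total≤ ⟩
        2 * d * (2 * r * p₁)           ≡⟨ e₄ d r p₁ ⟩
        4 * r * (d * p₁)               ≡⟨ cong (4 * r *_) (sym S≡) ⟩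
        4 * r * S                      ≤⟨ *-monoʳ-≤ (4 * r) (m≤n+∣n-m∣ S (Total * Y)) ⟩
        4 * r * (Total * Y + D)        ≡⟨ e₅ r Total Y D ⟩
        4 * r * Y * Total + 4 * r * D  ≤⟨ +-monoˡ-≤ (4 * r * D) (*-monoˡ-≤ Total (≤ᵇ-true (4 * r * Y) d bad)) ⟩
        d * Total + 4 * r * D          ∎)
        where
        Y = Diagonal.count σ
        D = ∣ Total * Y - S ∣

    -- The mean is at most d / (16 r), so reaching d / (8 r) is a deviation of d / (16 r). The
    -- variance is at most 3 d² / r⁴ ≤ 3 d / (64 r), and 16² · 3 / 64 = 12.
    many-early-squares : ∑[ σ ∈ perms xs ] 𝟙 (d ≤ᵇ 8 * r * OffDiagonal.count σ) * d ≤ 12 * r * Total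
    many-early-squares = OffDiagonal.deviation _ 16 12 d r R-bound deviates
      where
      p₄ = placements 4
      p₇ = placements 7
      q = r ^ 3
      S = ∑ (perms xs) OffDiagonal.count
      64d≢0 : NonZero (64 * d)
      64d≢0 = m*n≢0 64 d
      e₁ : ∀ d r p → r * (r * (r * 1)) * (16 * r * (d * d * p)) ≡ 16 * (d * d * (p * (r * (r * (r * (r * 1))))))
      e₁ = solve-∀
      e₂ : ∀ d T → 16 * (d * d * T) + 48 * (d * d * T) ≡ 64 * d * (d * T)
      e₂ = solve-∀
      S-bound : 16 * r * S ≤ d * Total
      S-bound = *-cancelˡ-≤ (64 * d) {{64d≢0}} (begin
        64 * d * (16 * r * S)             ≤⟨ *-mono-≤ 64d≤r³ (*-monoʳ-≤ (16 * r) OffDiagonal.∑-count≤) ⟩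
        q * (16 * r * (d * d * p₄))       ≡⟨ e₁ d r p₄ ⟩
        16 * (d * d * (p₄ * r ^ 4))       ≤⟨ *-monoʳ-≤ 16 (*-monoʳ-≤ (d * d) (power 4)) ⟩
        -- Gives away a factor 4: the mean is in fact at most d / (64 r).
        16 * (d * d * Total)              ≤⟨ m≤m+n _ (48 * (d * d * Total)) ⟩
        16 * (d * d * Total) + 48 * (d * d * Total) ≡⟨ e₂ d Total ⟩
        64 * d * (d * Total)              ∎)
      e₃ : ∀ r d p₄ p₇ → d * d * (2 * p₄ + 4 * d * p₇) * (r * (r * (r * (r * (r * (r * (r * 1)))))))
           ≡ d * d * (2 * (r * (r * (r * 1))) * (p₄ * (r * (r * (r * (r * 1))))) + 4 * d * (p₇ * (r * (r * (r * (r * (r * (r * (r * 1)))))))))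
      e₃ = solve-∀
      e₄ : ∀ d q T → d * d * (2 * q * T + q * T) ≡ 3 * q * (d * d * T)
      e₄ = solve-∀
      -- Brings the contribution 4 d / r⁷ of squares sharing one edge below 1 / r⁴, the order of the
      -- contribution of coinciding squares.
      4d≤q : 4 * d ≤ q
      4d≤q = ≤-trans (*-monoˡ-≤ d (m≤m+n 4 60)) 64d≤r³
      R-power : OffDiagonal.R * r ^ 7 ≤ 3 * q * (d * d * Total)
      R-power = begin
        OffDiagonal.R * r ^ 7                                            ≤⟨ *-monoˡ-≤ (r ^ 7) OffDiagonal.R≤ ⟩
        d * d * (2 * p₄ + 4 * d * p₇) * r ^ 7                            ≡⟨ e₃ r d p₄ p₇ ⟩
        d * d * (2 * q * (p₄ * r ^ 4) + 4 * d * (p₇ * r ^ 7))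
          ≤⟨ *-monoʳ-≤ (d * d) (+-mono-≤ (*-monoʳ-≤ (2 * q) (power 4)) (*-mono-≤ 4d≤q (power 7))) ⟩
        d * d * (2 * q * Total + q * Total)                              ≡⟨ e₄ d q Total ⟩
        3 * q * (d * d * Total)                                          ∎
      e₅ : ∀ r R → r * (r * (r * 1)) * (r * (r * (r * 1))) * (16 * 16 * r * R) ≡ 256 * (R * (r * (r * (r * (r * (r * (r * (r * 1))))))))
      e₅ = solve-∀
      e₆ : ∀ q d T → 256 * (3 * q * (d * d * T)) ≡ q * (64 * d) * (12 * (d * T))
      e₆ = solve-∀
      R-bound : 16 * 16 * r * OffDiagonal.R ≤ 12 * (d * Total)
      R-bound = *-cancelˡ-≤ (q * (64 * d)) {{m*n≢0 q (64 * d) {{m^n≢0 r 3}} {{64d≢0}}}} (begin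
        q * (64 * d) * (16 * 16 * r * OffDiagonal.R)  ≤⟨ *-monoˡ-≤ (16 * 16 * r * OffDiagonal.R) (*-monoʳ-≤ q 64d≤r³) ⟩
        q * q * (16 * 16 * r * OffDiagonal.R)         ≡⟨ e₅ r OffDiagonal.R ⟩
        256 * (OffDiagonal.R * r ^ 7)                 ≤⟨ *-monoʳ-≤ 256 R-power ⟩
        256 * (3 * q * (d * d * Total))               ≡⟨ e₆ q d Total ⟩
        q * (64 * d) * (12 * (d * Total))             ∎)
      e₇ : ∀ d T → d * T + d * T ≡ 2 * (d * T)
      e₇ = solve-∀
      e₈ : ∀ r X T → 2 * (8 * r * X * T) ≡ 16 * r * (T * X)
      e₈ = solve-∀
      deviates : ∀ σ → σ ∈ perms xs → (d ≤ᵇ 8 * r * OffDiagonal.count σ) ≡ true →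
        d * Total ≤ 16 * r * ∣ Total * OffDiagonal.count σ - S ∣
      deviates σ _ bad = +-cancelˡ-≤ (d * Total) _ _ (begin
        d * Total + d * Total          ≡⟨ e₇ d Total ⟩
        2 * (d * Total)                ≤⟨ *-monoʳ-≤ 2 (*-monoˡ-≤ Total (≤ᵇ-true d (8 * r * X) bad)) ⟩
        2 * (8 * r * X * Total)        ≡⟨ e₈ r X Total ⟩
        16 * r * (Total * X)           ≤⟨ *-monoʳ-≤ (16 * r) (m≤n+∣m-n∣ (Total * X) S) ⟩
        16 * r * (S + D)               ≡⟨ *-distribˡ-+ (16 * r) S D ⟩
        16 * r * S + 16 * r * D        ≤⟨ +-monoˡ-≤ (16 * r * D) S-bound ⟩
        d * Total + 16 * r * D         ∎)
        where
        X = OffDiagonal.count σ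
        D = ∣ Total * X - S ∣

-- The hypercube and its 4-cycles

_≟ᵥ_ : DecidableEquality (Vertex d)
_≟ᵥ_ = Vec.≡-dec Bool._≟_

_≟ₑ_ : DecidableEquality (Edge d)
_≟ₑ_ = Product.≡-dec _≟ᵥ_ _≟ᵥ_

lookup-ext : {u w : Vec A d} → (∀ i → lookup u i ≡ lookup w i) → u ≡ w
lookup-ext {u = []}    {[]}    eq = refl
lookup-ext {u = x ∷ u} {y ∷ w} eq = cong₂ _∷_ (eq Fin.zero) (lookup-ext (eq ∘ Fin.suc))

flip : Vertex d → Fin d → Vertex d
flip u i = u [ i ]%= not

lookup-flip : (u : Vertex d) (i : Fin d) → lookup (flip u i) i ≡ not (lookup u i)
lookup-flip u i = Vec.lookup∘updateAt i u

lookup-flip-≢ : (u : Vertex d) {i j : Fin d} → j ≢ i → lookup (flip u i) j ≡ lookup u j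
lookup-flip-≢ u {i} {j} j≢i = Vec.lookup∘updateAt′ j i j≢i u

-- Coordinate i of u is overwritten in both components, so either endpoint names the edge by the
-- same pair, in the orientation stored by `qEdges`.
edge : Vertex d → Fin d → Edge d
edge u i = u [ i ]≔ false , u [ i ]≔ true

-- If i and j differed, the equations for the two endpoints would force `lookup w i` to be both
-- `false` and `true`.
edge-injective : (u w : Vertex d) {i j : Fin d} → edge u i ≡ edge w j →
                 i ≡ j × (∀ k → k ≢ i → lookup u k ≡ lookup w k)
edge-injective u w {i} {j} eq with i Fin.≟ j
... | yes refl = refl , λ k k≢i → trans (sym (Vec.lookup∘update′ k≢i u false))
        (trans (cong (λ e → lookup (proj₁ e) k) eq) (Vec.lookup∘update′ k≢i w false))
... | no i≢j = contradiction (trans (at false (cong proj₁ eq)) (sym (at true (cong proj₂ eq)))) λ ()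
  where
  at : ∀ b → u [ i ]≔ b ≡ w [ j ]≔ b → b ≡ lookup w i
  at b eq = trans (sym (Vec.lookup∘update i u b))
           (trans (cong (λ z → lookup z i) eq) (Vec.lookup∘update′ i≢j w b))

edge-≔ : (u : Vertex d) (i : Fin d) (b : Bool) → edge (u [ i ]≔ b) i ≡ edge u i
edge-≔ u i b = cong₂ _,_ (Vec.[]≔-idempotent u i) (Vec.[]≔-idempotent u i)

flip-≔ : (u : Vertex d) (i : Fin d) (b : Bool) → flip (u [ i ]≔ b) i ≡ u [ i ]≔ not b
flip-≔ u i b = Vec.updateAt-updateAt i u

edge-flip : (u : Vertex d) (i : Fin d) → edge (flip u i) i ≡ edge u i
edge-flip u i = cong₂ _,_ (Vec.updateAt-updateAt i u) (Vec.updateAt-updateAt i u)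

flip-involutive : (u : Vertex d) (i : Fin d) → flip (flip u i) i ≡ u
flip-involutive u i = trans (Vec.updateAt-updateAt i u)
  (Vec.updateAt-id-local i u (not-not (lookup u i)))
  where
  not-not : ∀ b → not (not b) ≡ b
  not-not true  = refl
  not-not false = refl

≔-eq : (u : Vertex d) (i : Fin d) {b : Bool} → lookup u i ≡ b → u [ i ]≔ b ≡ u
≔-eq u i refl = Vec.[]≔-lookup u i

≔-flip : (u : Vertex d) (i : Fin d) {b : Bool} → not (lookup u i) ≡ b → u [ i ]≔ b ≡ flip u i
≔-flip u i refl = sym (Vec.updateAt-cong-local i u refl)

-- For i ≢ j the edge joins flip v i to its neighbour at distance two from v in direction j,
-- while near v (i , i) is the edge at v in direction i: the 4-cycle at v in
-- directions i and j consists of the images of {i,j}².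
near : Vertex d → Fin d × Fin d → Edge d
near v (i , j) = edge (flip v i) j

-- The directions j and l agree by `edge-injective`, and then `flip v i` and `flip v k` agree away
-- from j. If i and k differed, these two vertices would differ at both i and k, so both would equal
-- j.
near-injective : (v : Vertex d) {p q : Fin d × Fin d} → near v p ≡ near v q → p ≡ q
near-injective v {i , j} {k , l} eq with edge-injective (flip v i) (flip v k) eq
... | refl , agree with i Fin.≟ k
...   | yes refl = refl
...   | no i≢k = contradiction (trans (position i i≢k (λ q → agree i q) (flipped i k i≢k))
                   (sym (position k (≢-sym i≢k) (λ q → sym (agree k q)) (flipped k i (≢-sym i≢k))))) i≢k
  where
  flipped : ∀ a b → a ≢ b → lookup (flip v a) a ≢ lookup (flip v b) a
  flipped a b a≢b eq = not-¬ {lookup v a} refl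
    (trans (sym (lookup-flip-≢ v a≢b)) (trans (sym eq) (lookup-flip v a)))
  position : ∀ a {b} → a ≢ b → (a ≢ j → lookup (flip v a) a ≡ lookup (flip v b) a) →
             lookup (flip v a) a ≢ lookup (flip v b) a → a ≡ j
  position a _ agree differ with a Fin.≟ j
  ... | yes a≡j = a≡j
  ... | no a≢j  = contradiction (agree a≢j) differ

∈-allV : (v : Vertex d) → v ∈ allV d
∈-allV []          = here refl
∈-allV (false ∷ v) = ∈-concatMap⁺ _ (Any.map (λ { refl → here refl }) (∈-allV v))
∈-allV (true ∷ v)  = ∈-concatMap⁺ _ (Any.map (λ { refl → there (here refl) }) (∈-allV v))

∑-allV-δ : (w : Vertex d) → ∑[ v ∈ allV d ] 𝟙 (does (v ≟ᵥ w)) ≡ 1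
∑-allV-δ []      = refl
∑-allV-δ {suc d} (b ∷ w) = trans (∑-concatMap _ (allV d) _)
  (trans (∑-cong (allV d) (λ v _ → one b v)) (∑-allV-δ w))
  where
  one : ∀ b v → ∑ ((false ∷ v) ∷ (true ∷ v) ∷ []) (λ u → 𝟙 (does (u ≟ᵥ (b ∷ w)))) ≡ 𝟙 (does (v ≟ᵥ w))
  one false v = +-identityʳ _
  one true  v = +-identityʳ _

lower-edge : (v : Vertex d) (i : Fin d) → lookup v i ≡ false → (v , v [ i ]≔ true) ≡ edge v i
lower-edge v i eq = cong (_, v [ i ]≔ true) (sym (≔-eq v i eq))

∈-qEdges⁻ : {e : Edge d} → e ∈ qEdges d → ∃[ u ] ∃[ i ] e ≡ edge u i
∈-qEdges⁻ {d} e∈ with find (∈-concatMap⁻ _ {xs = allV d} e∈)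
... | v , _ , e∈′ with find (∈-concatMap⁻ _ {xs = allFin d} e∈′)
...   | i , _ , e∈″ with lookup v i in eq | e∈″
...     | false | here refl = v , i , lower-edge v i eq

-- The sum over the list factors into a sum over lower endpoints and a sum over directions, each
-- with a single nonzero term.
qEdges-mult : (u : Vertex d) (i : Fin d) → ∑[ e ∈ qEdges d ] 𝟙 (does (e ≟ₑ edge u i)) ≡ 1
qEdges-mult {d} u i = begin
  ∑[ e ∈ qEdges d ] 𝟙 (does (e ≟ₑ edge u i))
    ≡⟨ ∑-concatMap _ (allV d) _ ⟩
  ∑[ v ∈ allV d ] ∑ (concatMap _ (allFin d)) δ
    ≡⟨ ∑-cong (allV d) (λ v _ → trans (∑-concatMap _ (allFin d) δ) (∑-cong (allFin d) (λ j _ → single v j))) ⟩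
  ∑[ v ∈ allV d ] ∑[ j ∈ allFin d ] (𝟙 (does (v ≟ᵥ (u [ i ]≔ false))) * 𝟙 (does (j Fin.≟ i)))
    ≡⟨ ∑-*-∑ (allV d) (allFin d) _ _ ⟩
  ∑[ v ∈ allV d ] 𝟙 (does (v ≟ᵥ (u [ i ]≔ false))) * ∑[ j ∈ allFin d ] 𝟙 (does (j Fin.≟ i))
    ≡⟨ cong₂ _*_ (∑-allV-δ (u [ i ]≔ false)) (∑-allFin-δ i) ⟩
  1 ∎
  where
  open ≡-Reasoning
  δ : Edge d → ℕ
  δ e = 𝟙 (does (e ≟ₑ edge u i))
  single : ∀ v j → ∑ (if lookup v j then [] else ((v , v [ j ]≔ true) ∷ [])) δ
                   ≡ 𝟙 (does (v ≟ᵥ (u [ i ]≔ false))) * 𝟙 (does (j Fin.≟ i))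
  single v j with v ≟ᵥ (u [ i ]≔ false) | j Fin.≟ i
  ... | yes refl | yes refl rewrite Vec.lookup∘update i u false =
    trans (+-identityʳ _) (cong 𝟙 (dec-true ((u [ i ]≔ false , (u [ i ]≔ false) [ i ]≔ true) ≟ₑ edge u i)
      (cong (u [ i ]≔ false ,_) (Vec.[]≔-idempotent u i))))
  ... | no v≢ | _ with lookup v j
  ...   | true  = refl
  ...   | false = trans (+-identityʳ _) (cong 𝟙 (dec-false ((v , v [ j ]≔ true) ≟ₑ edge u i) (v≢ ∘ cong proj₁)))
  single v j | yes v≡ | no j≢i with lookup v j in eq
  ...   | true  = refl
  ...   | false = trans (+-identityʳ _) (cong 𝟙 (dec-false ((v , v [ j ]≔ true) ≟ₑ edge u i)
                    (λ e≡ → j≢i (proj₁ (edge-injective v u (trans (sym (lower-edge v j eq)) e≡))))))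

-- Reflecting the Boolean 4-cycle test

does-sound : {P : Set} (P? : Dec P) → T (does P?) → P
does-sound (yes p) _ = p

does-complete : {P : Set} (P? : Dec P) → P → T (does P?)
does-complete (yes _) _ = _
does-complete (no ¬p) p = contradiction p ¬p

not-does-sound : {P : Set} (P? : Dec P) → T (not (does P?)) → ¬ P
not-does-sound (no ¬p) _ = ¬p

not-does-complete : {P : Set} (P? : Dec P) → ¬ P → T (not (does P?))
not-does-complete (yes p) ¬p = contradiction p ¬p
not-does-complete (no _)  _  = _

module _ {x y : Bool} where
  open Equivalence (T-∧ {x} {y}) using () renaming (to to ∧⁻; from to ∧⁺) public
  open Equivalence (T-∨ {x} {y}) using () renaming (to to ∨⁻; from to ∨⁺) public

Joins : Edge d → Vertex d → Vertex d → Set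
Joins e a b = e ≡ (a , b) ⊎ e ≡ (b , a)

Adjacent : Graph d → Vertex d → Vertex d → Set
Adjacent G a b = Any (λ e → Joins e a b) G

adj⁻ : (G : Graph d) (a b : Vertex d) → T (adj G a b) → Adjacent G a b
adj⁻ G a b t = Any.map (λ {e} → joins e) (any⁻ _ G t)
  where
  joins : ∀ e → T (((proj₁ e =ᵥ a) ∧ (proj₂ e =ᵥ b)) ∨ ((proj₁ e =ᵥ b) ∧ (proj₂ e =ᵥ a))) → Joins e a b
  joins (x , y) t = Sum.map (eqs a b) (eqs b a) (∨⁻ t)
    where
    eqs : ∀ a b → T ((x =ᵥ a) ∧ (y =ᵥ b)) → (x , y) ≡ (a , b)
    eqs a b t = cong₂ _,_ (does-sound (x ≟ᵥ a) (proj₁ (∧⁻ t))) (does-sound (y ≟ᵥ b) (proj₂ (∧⁻ {x =ᵥ a} t)))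

adj⁺ : (G : Graph d) (a b : Vertex d) → Adjacent G a b → T (adj G a b)
adj⁺ G a b p = any⁺ _ (Any.map joins p)
  where
  both : ∀ {x y} → T ((x =ᵥ x) ∧ (y =ᵥ y))
  both {x} {y} = ∧⁺ (does-complete (x ≟ᵥ x) refl , does-complete (y ≟ᵥ y) refl)
  joins : ∀ {e} → Joins e a b → T (((proj₁ e =ᵥ a) ∧ (proj₂ e =ᵥ b)) ∨ ((proj₁ e =ᵥ b) ∧ (proj₂ e =ᵥ a)))
  joins (inj₁ refl) = ∨⁺ (inj₁ (both {a} {b}))
  joins (inj₂ refl) = ∨⁺ {(b =ᵥ a) ∧ (a =ᵥ b)} (inj₂ (both {b} {a}))

Adjacent-sym : {G : Graph d} {a b : Vertex d} → Adjacent G a b → Adjacent G b a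
Adjacent-sym = Any.map Sum.swap

record Quad (G : Graph d) (a b c e : Vertex d) : Set where
  constructor quad
  field
    a≢b : a ≢ b
    a≢c : a ≢ c
    a≢e : a ≢ e
    b≢c : b ≢ c
    b≢e : b ≢ e
    c≢e : c ≢ e
    ab  : Adjacent G a b
    bc  : Adjacent G b c
    ce  : Adjacent G c e
    ea  : Adjacent G e a

rotate : {G : Graph d} {a b c e : Vertex d} → Quad G a b c e → Quad G b c e a
rotate (quad a≢b a≢c a≢e b≢c b≢e c≢e ab bc ce ea) =
  quad b≢c b≢e (≢-sym a≢b) c≢e (≢-sym a≢c) (≢-sym a≢e) bc ce ea ab

reflect : {G : Graph d} {a b c e : Vertex d} → Quad G a b c e → Quad G b a e c
reflect (quad a≢b a≢c a≢e b≢c b≢e c≢e ab bc ce ea) =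
  quad (≢-sym a≢b) b≢e b≢c a≢e a≢c (≢-sym c≢e) (Adjacent-sym ab) (Adjacent-sym ea) (Adjacent-sym ce) (Adjacent-sym bc)

∃-any : (p : Vertex d → Bool) → T (any p (allV d)) → ∃[ v ] T (p v)
∃-any {d} p t = proj₁ found , proj₂ (proj₂ found)
  where found = find (any⁻ p (allV d) t)

any-∃ : (p : Vertex d → Bool) (v : Vertex d) → T (p v) → T (any p (allV d))
any-∃ p v t = any⁺ p (lose (∈-allV v) t)

isQuad : Graph d → (a b c e : Vertex d) → Bool
isQuad G a b c e = distinct4 a b c e ∧ adj G a b ∧ adj G b c ∧ adj G c e ∧ adj G e a

isQuad⁻ : (G : Graph d) (a b c e : Vertex d) → T (isQuad G a b c e) → Quad G a b c e
isQuad⁻ G a b c e t = quad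
  (not-does-sound (a ≟ᵥ b) (proj₁ d₁)) (not-does-sound (a ≟ᵥ c) (proj₁ d₂)) (not-does-sound (a ≟ᵥ e) (proj₁ d₃))
  (not-does-sound (b ≟ᵥ c) (proj₁ d₄)) (not-does-sound (b ≟ᵥ e) (proj₁ d₅)) (not-does-sound (c ≟ᵥ e) (proj₂ d₅))
  (adj⁻ G a b (proj₁ a₁)) (adj⁻ G b c (proj₁ a₂)) (adj⁻ G c e (proj₁ a₃)) (adj⁻ G e a (proj₂ a₃))
  where
  t′ = ∧⁻ {distinct4 a b c e} t
  d₁ = ∧⁻ {not (a =ᵥ b)} (proj₁ t′)
  d₂ = ∧⁻ {not (a =ᵥ c)} (proj₂ d₁)
  d₃ = ∧⁻ {not (a =ᵥ e)} (proj₂ d₂)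
  d₄ = ∧⁻ {not (b =ᵥ c)} (proj₂ d₃)
  d₅ = ∧⁻ {not (b =ᵥ e)} (proj₂ d₄)
  a₁ = ∧⁻ {adj G a b} (proj₂ t′)
  a₂ = ∧⁻ {adj G b c} (proj₂ a₁)
  a₃ = ∧⁻ {adj G c e} (proj₂ a₂)

isQuad⁺ : (G : Graph d) (a b c e : Vertex d) → Quad G a b c e → T (isQuad G a b c e)
isQuad⁺ G a b c e (quad a≢b a≢c a≢e b≢c b≢e c≢e ab bc ce ea) =
  ∧⁺ {distinct4 a b c e} (dist , adjs)
  where
  dist : T (distinct4 a b c e)
  dist = ∧⁺ {not (a =ᵥ b)} (not-does-complete (a ≟ᵥ b) a≢b ,
         ∧⁺ {not (a =ᵥ c)} (not-does-complete (a ≟ᵥ c) a≢c ,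
         ∧⁺ {not (a =ᵥ e)} (not-does-complete (a ≟ᵥ e) a≢e ,
         ∧⁺ {not (b =ᵥ c)} (not-does-complete (b ≟ᵥ c) b≢c ,
         ∧⁺ {not (b =ᵥ e)} (not-does-complete (b ≟ᵥ e) b≢e , not-does-complete (c ≟ᵥ e) c≢e)))))
  adjs : T (adj G a b ∧ adj G b c ∧ adj G c e ∧ adj G e a)
  adjs = ∧⁺ {adj G a b} (adj⁺ G a b ab , ∧⁺ {adj G b c} (adj⁺ G b c bc ,
         ∧⁺ {adj G c e} (adj⁺ G c e ce , adj⁺ G e a ea)))

-- A datatype rather than an equation, so that type checking never unfolds hasQ2.
data HasQ2 {d} (G : Graph d) : Set where
  hasQ2-true : hasQ2 G ≡ true → HasQ2 G

hasQ2⁻ : (G : Graph d) → HasQ2 G → ∃[ a ] ∃[ b ] ∃[ c ] ∃[ e ] Quad G a b c e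
hasQ2⁻ {d} G (hasQ2-true eq) = proj₁ a , proj₁ b , proj₁ c , proj₁ e ,
  isQuad⁻ G (proj₁ a) (proj₁ b) (proj₁ c) (proj₁ e) (proj₂ e)
  where
  V = allV d
  a = ∃-any (λ a → any (λ b → any (λ c → any (isQuad G a b c) V) V) V) (Equivalence.from T-≡ eq)
  b = ∃-any (λ b → any (λ c → any (isQuad G (proj₁ a) b c) V) V) (proj₂ a)
  c = ∃-any (λ c → any (isQuad G (proj₁ a) (proj₁ b) c) V) (proj₂ b)
  e = ∃-any (isQuad G (proj₁ a) (proj₁ b) (proj₁ c)) (proj₂ c)

hasQ2⁺ : {G : Graph d} {a b c e : Vertex d} → Quad G a b c e → HasQ2 G
hasQ2⁺ {d} {G} {a} {b} {c} {e} q = hasQ2-true (Equivalence.to T-≡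
  (any-∃ (λ a → any (λ b → any (λ c → any (isQuad G a b c) V) V) V) a
    (any-∃ (λ b → any (λ c → any (isQuad G a b c) V) V) b
      (any-∃ (λ c → any (isQuad G a b c) V) c (any-∃ (isQuad G a b c) e (isQuad⁺ G a b c e q))))))
  where V = allV d

-- 4-cycles of the cube through a given edge

IsEdge : Edge d → Set
IsEdge e = ∃[ u ] ∃[ i ] e ≡ edge u i

joins-edge : {a b : Vertex d} {e : Edge d} → IsEdge e → Joins e a b → ∃[ i ] b ≡ flip a i × e ≡ edge a i
joins-edge (u , i , refl) (inj₁ refl) = i , sym (flip-≔ u i false) , sym (edge-≔ u i false)
joins-edge (u , i , refl) (inj₂ refl) = i , sym (flip-≔ u i true) , sym (edge-≔ u i true)

Adjacent⇒flip : {G : Graph d} {a b : Vertex d} → (∀ e → e ∈ G → IsEdge e) → Adjacent G a b →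
                ∃[ i ] b ≡ flip a i × edge a i ∈ G
Adjacent⇒flip cube p with find p
... | e , e∈ , joins with joins-edge (cube e e∈) joins
...   | i , eq , refl = i , eq , e∈

edge-joins : (v : Vertex d) (i : Fin d) {a b : Vertex d} → Joins (edge v i) a b →
             (a ≡ v × b ≡ flip v i) ⊎ (a ≡ flip v i × b ≡ v)
edge-joins v i joins with lookup v i in eq | joins
... | false | inj₁ refl = inj₁ (≔-eq v i eq , ≔-flip v i (cong not eq))
... | false | inj₂ refl = inj₂ (≔-flip v i (cong not eq) , ≔-eq v i eq)
... | true  | inj₁ refl = inj₂ (≔-flip v i (cong not eq) , ≔-eq v i eq)
... | true  | inj₂ refl = inj₁ (≔-eq v i eq , ≔-flip v i (cong not eq))

-- The left side differs from v at i. On the right only l can account for this, since k is not i, so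
-- l = i. The left side also differs from v at j, and now only k can account for that.
flips-commute : (v : Vertex d) {i j k l : Fin d} → i ≢ j → i ≢ k →
  flip (flip v i) j ≡ flip (flip v k) l → k ≡ j × l ≡ i
flips-commute v {i} {j} {k} {l} i≢j i≢k eq = k≡j , l≡i
  where
  at : ∀ x → lookup (flip (flip v i) j) x ≡ lookup (flip (flip v k) l) x
  at x = cong (λ z → lookup z x) eq
  l≡i : l ≡ i
  l≡i with l Fin.≟ i
  ... | yes l≡i = l≡i
  ... | no  l≢i = contradiction
    (trans (sym (lookup-flip-≢ v i≢k)) (trans (sym (lookup-flip-≢ (flip v k) (≢-sym l≢i)))
      (trans (sym (at i)) (trans (lookup-flip-≢ (flip v i) i≢j) (lookup-flip v i)))))
    (not-¬ refl)
  k≡j : k ≡ j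
  k≡j with k Fin.≟ j
  ... | yes k≡j = k≡j
  ... | no  k≢j = contradiction
    (trans (sym (lookup-flip-≢ v (≢-sym k≢j))) (trans (sym (lookup-flip-≢ (flip v k) (λ j≡l → i≢j (sym (trans j≡l l≡i)))))
      (trans (sym (at j)) (trans (lookup-flip (flip v i) j) (cong not (lookup-flip-≢ v (≢-sym i≢j)))))))
    (not-¬ refl)

-- The corner z is reached by two flips from v, through `flip v i` and through w. By `flips-commute`
-- the two routes use the same pair of directions in opposite order, which identifies w as
-- `flip v j`. The side conditions hold because i = j would give z = v, and i = k would give w =
-- `flip v i`.
quad⇒square : {G : Graph d} {v z w : Vertex d} {i : Fin d} → (∀ e → e ∈ G → IsEdge e) → edge v i ∈ G →
  Quad G v (flip v i) z w → ∃[ j ] i ≢ j × (∀ p → p ∈ square i j → near v p ∈ G)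
quad⇒square {G = G} {v} {z} {w} {i} cube vi∈ (quad _ v≢z _ _ vi≢w _ _ bc ce ea)
  with Adjacent⇒flip cube bc | Adjacent⇒flip cube (Adjacent-sym ea) | Adjacent⇒flip cube (Adjacent-sym ce)
... | j , refl , ij∈ | k , refl , vk∈ | l , z≡ , kl∈
  with flips-commute v
    (λ { refl → v≢z (sym (flip-involutive v i)) }) (λ { refl → vi≢w refl }) z≡
... | refl , refl = j , (λ { refl → v≢z (sym (flip-involutive v i)) }) , inside
  where
  inside : ∀ p → p ∈ square i j → near v p ∈ G
  inside _ (here refl)                         = subst (_∈ G) (sym (edge-flip v i)) vi∈
  inside _ (there (here refl))                 = ij∈
  inside _ (there (there (here refl)))         = kl∈
  inside _ (there (there (there (here refl)))) = subst (_∈ G) (sym (edge-flip v j)) vk∈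

-- As G is free, some side of the new 4-cycle is the added edge. Rotation makes it the first side,
-- and reflection corrects its direction.
closes⇒square : {G : Graph d} (v : Vertex d) (i : Fin d) → (∀ e → e ∈ G → IsEdge e) →
  ¬ HasQ2 G → HasQ2 (edge v i ∷ G) →
  ∃[ j ] i ≢ j × (∀ p → p ∈ square i j → near v p ∈ edge v i ∷ G)
closes⇒square {G = G} v i cubeG free closes = main (hasQ2⁻ (edge v i ∷ G) closes)
  where
  Goal : Set
  Goal = ∃[ j ] i ≢ j × (∀ p → p ∈ square i j → near v p ∈ edge v i ∷ G)
  cube : ∀ e → e ∈ edge v i ∷ G → IsEdge e
  cube _ (here refl) = v , i , refl
  cube e (there e∈)  = cubeG e e∈
  uses : ∀ {a b c e} → Quad (edge v i ∷ G) a b c e → Joins (edge v i) a b → Goal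
  uses q joins with edge-joins v i joins
  ... | inj₁ (refl , refl) = quad⇒square cube (here refl) q
  ... | inj₂ (refl , refl) = quad⇒square cube (here refl) (reflect q)
  main : ∃[ a ] ∃[ b ] ∃[ c ] ∃[ e ] Quad (edge v i ∷ G) a b c e → Goal
  main (_ , _ , _ , _ , q@(quad _ _ _ _ _ _ (here j) _ _ _)) = uses q j
  main (_ , _ , _ , _ , q@(quad _ _ _ _ _ _ (there _) (here j) _ _)) = uses (rotate q) j
  main (_ , _ , _ , _ , q@(quad _ _ _ _ _ _ (there _) (there _) (here j) _)) = uses (rotate (rotate q)) j
  main (_ , _ , _ , _ , q@(quad _ _ _ _ _ _ (there _) (there _) (there _) (here j))) = uses (rotate (rotate (rotate q))) j
  main (_ , _ , _ , _ , quad a≢b a≢c a≢e b≢c b≢e c≢e (there ab) (there bc) (there ce) (there ea)) =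
    contradiction (hasQ2⁺ (quad a≢b a≢c a≢e b≢c b≢e c≢e ab bc ce ea)) free

hasQ2-[] : ¬ HasQ2 {d} []
hasQ2-[] {d} t = empty (hasQ2⁻ {d} [] t)
  where
  empty : ¬ (∃[ a ] ∃[ b ] ∃[ c ] ∃[ e ] Quad {d} [] a b c e)
  empty (_ , _ , _ , _ , quad _ _ _ _ _ _ () _ _ _)

-- The greedy process on a prefix of the ordering

greedy-⊇ : (G : Graph d) (es : List (Edge d)) {e : Edge d} → e ∈ G → e ∈ greedy G es
greedy-⊇ G []       e∈ = e∈
greedy-⊇ G (x ∷ es) {e} e∈ = step (hasQ2 (x ∷ G))
  where
  step : ∀ b → e ∈ (if b then greedy G es else greedy (x ∷ G) es)
  step true  = greedy-⊇ G es e∈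
  step false = greedy-⊇ (x ∷ G) es (there e∈)

-- The witness H is the graph held by the process when e is scanned.
Rejected : Graph d → List (Edge d) → Edge d → Set
Rejected G pre e = ∃[ H ] ¬ HasQ2 H × HasQ2 (e ∷ H) × (∀ x → x ∈ H → x ∈ G ⊎ x ∈ pre)

-- Freeness of the current graph is the invariant of the induction: a refused edge leaves the graph
-- unchanged, and an accepted one passed the test. The fate of e is settled within `pre`, whatever
-- `post` is.
greedy-rejects : (G : Graph d) (pre post : List (Edge d)) {e : Edge d} → ¬ HasQ2 G → e ∈ pre →
  e ∈ greedy G (pre ++ post) ⊎ Rejected G pre e
greedy-rejects {d} G (x ∷ pre) post {e} free e∈ = step (hasQ2 (x ∷ G)) refl e∈
  where
  not-hasQ2 : ∀ {H : Graph d} → hasQ2 H ≡ false → ¬ HasQ2 H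
  not-hasQ2 eq (hasQ2-true eq′) = contradiction (trans (sym eq′) eq) λ ()
  skip : Rejected G pre e → Rejected G (x ∷ pre) e
  skip (H , f , c , H⊆) = H , f , c , λ y y∈ → Sum.map₂ there (H⊆ y y∈)
  keep : Rejected (x ∷ G) pre e → Rejected G (x ∷ pre) e
  keep (H , f , c , H⊆) = H , f , c , λ y y∈ → move (H⊆ y y∈)
    where
    move : ∀ {y} → y ∈ x ∷ G ⊎ y ∈ pre → y ∈ G ⊎ y ∈ x ∷ pre
    move (inj₁ (here y≡x)) = inj₂ (here y≡x)
    move (inj₁ (there y∈)) = inj₁ y∈
    move (inj₂ y∈)         = inj₂ (there y∈)
  step : ∀ b → hasQ2 (x ∷ G) ≡ b → e ∈ x ∷ pre →
    e ∈ (if b then greedy G (pre ++ post) else greedy (x ∷ G) (pre ++ post)) ⊎ Rejected G (x ∷ pre) e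
  step true  eq (here refl) = inj₂ (G , free , hasQ2-true eq , λ _ → inj₁)
  step true  eq (there e∈′) = Sum.map₂ skip (greedy-rejects G pre post free e∈′)
  step false eq (here refl) = inj₁ (greedy-⊇ (x ∷ G) (pre ++ post) (here refl))
  step false eq (there e∈′) = Sum.map₂ keep (greedy-rejects (x ∷ G) pre post (not-hasQ2 eq) e∈′)

-- The degree of a fixed vertex

module _ {A : Set} (_≟_ : DecidableEquality A) where

  ∈⇒1≤∑δ : {x : A} {ys : List A} → x ∈ ys → 1 ≤ ∑[ y ∈ ys ] 𝟙 (does (y ≟ x))
  ∈⇒1≤∑δ {x} x∈ = ≤-trans (≤-reflexive (sym (cong 𝟙 (dec-true (x ≟ x) refl)))) (term≤∑ _ x∈)

  1≤∑δ⇒∈ : {x : A} (ys : List A) → 1 ≤ ∑[ y ∈ ys ] 𝟙 (does (y ≟ x)) → x ∈ ys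
  1≤∑δ⇒∈ {x} (y ∷ ys) 1≤ with y ≟ x
  ... | yes refl = here refl
  ... | no _     = there (1≤∑δ⇒∈ ys 1≤)

near-mult : ∀ {d} (v : Vertex d) p → ∑[ e ∈ qEdges d ] 𝟙 (does (e ≟ₑ near v p)) ≡ 1
near-mult v (i , j) = qEdges-mult (flip v i) j

module At {d : ℕ} (v : Vertex d) (m : ℕ) (m≤N : m ≤ length (qEdges d)) where

  open DecMembership (_≟ₑ_ {d}) using (_∈?_)
  open Placement (_≟ₑ_ {d}) (qEdges d) m m≤N using (mult; early) public
  open Grid (_≟ₑ_ {d}) (qEdges d) m m≤N (near v) (near-injective v) (near-mult v) public

  incident : Edge d → Bool
  incident e = (proj₁ e =ᵥ v) ∨ (proj₂ e =ᵥ v)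

  near-diagonal : ∀ i → near v (i , i) ≡ edge v i
  near-diagonal i = edge-flip v i

  edge-incident : ∀ i → incident (edge v i) ≡ true
  edge-incident i = endpoint (lookup v i) refl
    where
    endpoint : ∀ b → lookup v i ≡ b → incident (edge v i) ≡ true
    endpoint false eq rewrite ≔-eq v i eq | dec-true (v ≟ᵥ v) refl = refl
    endpoint true  eq rewrite ≔-eq v i eq | dec-true (v ≟ᵥ v) refl = ∨-zeroʳ _

  -- Different directions give different edges at v, so e matches at most one of them.
  ∑-near≤incident : ∀ e → ∑[ i ∈ allFin d ] 𝟙 (does (e ≟ₑ near v (i , i))) ≤ 𝟙 (incident e)
  ∑-near≤incident e with Fin.any? (λ i → e ≟ₑ near v (i , i))
  ... | no none = ≤-trans (≤-reflexive (trans
        (∑-cong (allFin d) (λ i _ → cong 𝟙 (dec-false (e ≟ₑ near v (i , i)) (λ eq → none (i , eq)))))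
        (trans (∑-allFin-const d 0) (*-zeroʳ d)))) z≤n
  ... | yes (i , refl) = ≤-reflexive (trans
        (∑-cong (allFin d) (λ j _ → same j))
        (trans (∑-allFin-δ i) (sym (cong 𝟙 (trans (cong incident (near-diagonal i)) (edge-incident i))))))
    where
    same : ∀ j → 𝟙 (does (near v (i , i) ≟ₑ near v (j , j))) ≡ 𝟙 (does (j Fin.≟ i))
    same j with j Fin.≟ i
    ... | yes refl = cong 𝟙 (dec-true (near v (i , i) ≟ₑ near v (i , i)) refl)
    ... | no j≢i   = cong 𝟙 (dec-false (near v (i , i) ≟ₑ near v (j , j))
                       (λ eq → j≢i (sym (cong proj₁ (near-injective v eq)))))

  ∑-mult≤degree : ∀ G → ∑[ i ∈ allFin d ] mult (near v (i , i)) G ≤ degree G v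
  ∑-mult≤degree G = begin
    ∑[ i ∈ allFin d ] mult (near v (i , i)) G
      ≡⟨ ∑-swap (allFin d) G _ ⟩
    ∑[ e ∈ G ] ∑[ i ∈ allFin d ] 𝟙 (does (e ≟ₑ near v (i , i)))
      ≤⟨ ∑-mono G (λ e _ → ∑-near≤incident e) ⟩
    ∑[ e ∈ G ] 𝟙 (incident e)
      ≡⟨ sym (length-filterᵇ incident G) ⟩
    degree G v ∎
    where open ≤-Reasoning

  module _ {σ : List (Edge d)} (σ∈ : σ ∈ perms (qEdges d)) where

    mult-σ : ∀ e → mult e σ ≡ mult e (qEdges d)
    mult-σ e = ∑-perm (qEdges d) _ σ∈

    near∈σ : ∀ p → near v p ∈ σ
    near∈σ p = 1≤∑δ⇒∈ _≟ₑ_ σ (≤-reflexive (sym (trans (mult-σ (near v p)) (near-mult v p))))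

    σ-edges : ∀ {e} → e ∈ σ → IsEdge e
    σ-edges {e} e∈ = ∈-qEdges⁻ (1≤∑δ⇒∈ _≟ₑ_ (qEdges d)
      (≤-trans (∈⇒1≤∑δ _≟ₑ_ e∈) (≤-reflexive (mult-σ e))))

    take⊆σ : ∀ {e} → e ∈ take m σ → e ∈ σ
    take⊆σ {e} e∈ = subst (e ∈_) (take++drop≡id m σ) (∈-++⁺ˡ e∈)

    near∉drop : ∀ p → near v p ∈ take m σ → near v p ∉ drop m σ
    near∉drop p ∈take ∈drop = contradiction 2≤1 λ { (s≤s ()) }
      where
      open ≤-Reasoning
      2≤1 : 2 ≤ 1
      2≤1 = begin
        2 ≤⟨ +-mono-≤ (∈⇒1≤∑δ _≟ₑ_ ∈take) (∈⇒1≤∑δ _≟ₑ_ ∈drop) ⟩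
        mult (near v p) (take m σ) + mult (near v p) (drop m σ) ≡⟨ sym (∑-++ (take m σ) (drop m σ) _) ⟩
        mult (near v p) (take m σ ++ drop m σ) ≡⟨ cong (mult (near v p)) (take++drop≡id m σ) ⟩
        mult (near v p) σ ≡⟨ trans (mult-σ (near v p)) (near-mult v p) ⟩
        1 ∎

    early-take : ∀ ps → (∀ p → p ∈ ps → near v p ∈ take m σ) → early (map (near v) ps) σ ≡ 1
    early-take ps inside = clear-drop m σ outside
      where
      outside : ∀ e → e ∈ drop m σ → does (e ∈? map (near v) ps) ≡ false
      outside e e∈ = dec-false (e ∈? map (near v) ps) λ e∈′ → absurd (∈-map⁻ (near v) e∈′) e∈
        where
        absurd : ∀ {e} → ∃[ p ] p ∈ ps × e ≡ near v p → e ∉ drop m σ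
        absurd (p , p∈ , refl) = near∉drop p (inside p p∈)

    -- A refused edge in direction i is charged to an ordered pair whose first entry is i. Summing
    -- over i then counts each ordered pair once, which is why X counts ordered pairs.
    squaresAt : Fin d → ℕ
    squaresAt i = ∑[ p ∈ offDiagonal d ] (𝟙 (does (i Fin.≟ proj₁ p)) * early (OffDiagonal.K p) σ)

    early-diagonal≤ : ∀ i → early (Diagonal.K i) σ ≤ mult (near v (i , i)) (finalGraph σ) + squaresAt i
    early-diagonal≤ i = split (early (Diagonal.K i) σ) refl
      where
      ii = near v (i , i)
      keyed : does (ii ∈? (ii ∷ [])) ≡ true
      keyed = dec-true (ii ∈? (ii ∷ [])) (here refl)
      rejected : ii ∈ take m σ → Rejected [] (take m σ) ii → 1 ≤ squaresAt i
      rejected ii∈ (H , free , closes , H⊆) with closes⇒square v i H-edges free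
                                                    (subst (λ e → HasQ2 (e ∷ H)) (near-diagonal i) closes)
        where
        H-edges : ∀ e → e ∈ H → IsEdge e
        H-edges e e∈ with H⊆ e e∈
        ... | inj₂ e∈take = σ-edges (take⊆σ e∈take)
      ... | j , i≢j , inside = begin
        1                                          ≡⟨ sym (cong₂ _*_ (cong 𝟙 (dec-true (i Fin.≟ i) refl)) (early-take (square i j) inside′)) ⟩
        𝟙 (does (i Fin.≟ i)) * early (OffDiagonal.K (i , j)) σ
          ≤⟨ term≤∑ (λ p → 𝟙 (does (i Fin.≟ proj₁ p)) * early (OffDiagonal.K p) σ) (∈-offDiagonal⁺ i≢j) ⟩
        squaresAt i                                     ∎
        where
        open ≤-Reasoning
        locate : ∀ {e} → e ∈ edge v i ∷ H → e ∈ take m σ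
        locate (here refl) = subst (_∈ take m σ) (near-diagonal i) ii∈
        locate (there e∈) with H⊆ _ e∈
        ... | inj₂ e∈take = e∈take
        inside′ : ∀ p → p ∈ square i j → near v p ∈ take m σ
        inside′ p p∈ = locate (inside p p∈)
      one : ii ∈ take m σ → 1 ≤ mult ii (finalGraph σ) + squaresAt i
      one ii∈ with greedy-rejects [] (take m σ) (drop m σ) (hasQ2-[] {d}) ii∈
      ... | inj₂ rej = ≤-trans (rejected ii∈ rej) (m≤n+m _ _)
      ... | inj₁ ii∈final = ≤-trans (∈⇒1≤∑δ _≟ₑ_
              (subst (λ τ → ii ∈ finalGraph τ) (take++drop≡id m σ) ii∈final)) (m≤m+n _ _)
      split : ∀ n → early (Diagonal.K i) σ ≡ n → n ≤ mult ii (finalGraph σ) + squaresAt i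
      split zero    eq = z≤n
      split (suc n) eq = ≤-trans (subst (_≤ 1) eq (clear≤1 _ m σ))
        (one (clear⇒∈take m (≤-trans (s≤s z≤n) (≤-reflexive (sym eq))) keyed (near∈σ (i , i))))

    ∑-squaresAt : ∑ (allFin d) squaresAt ≡ OffDiagonal.count σ
    ∑-squaresAt = begin
      ∑ (allFin d) squaresAt
        ≡⟨ ∑-swap (allFin d) (offDiagonal d) _ ⟩
      ∑[ p ∈ offDiagonal d ] ∑[ i ∈ allFin d ] (𝟙 (does (i Fin.≟ proj₁ p)) * early (OffDiagonal.K p) σ)
        ≡⟨ ∑-cong (offDiagonal d) (λ p _ → trans (∑-*ʳ (allFin d) _ _)
             (trans (cong (_* early (OffDiagonal.K p) σ) (∑-allFin-δ (proj₁ p))) (*-identityˡ _))) ⟩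
      OffDiagonal.count σ ∎
      where open ≡-Reasoning

    early≤degree+squares : Diagonal.count σ ≤ degree (finalGraph σ) v + OffDiagonal.count σ
    early≤degree+squares = begin
      Diagonal.count σ
        ≤⟨ ∑-mono (allFin d) (λ i _ → early-diagonal≤ i) ⟩
      ∑[ i ∈ allFin d ] (mult (near v (i , i)) (finalGraph σ) + squaresAt i)
        ≡⟨ ∑-distrib-+ (allFin d) _ squaresAt ⟩
      ∑[ i ∈ allFin d ] mult (near v (i , i)) (finalGraph σ) + ∑ (allFin d) squaresAt
        ≤⟨ +-mono-≤ (∑-mult≤degree (finalGraph σ)) (≤-reflexive ∑-squaresAt) ⟩
      degree (finalGraph σ) v + OffDiagonal.count σ ∎
      where open ≤-Reasoning

-- Choice of parameters

-- An integer substitute for the cube root, exact up to a factor 2. The value s is kept as long as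
-- its cube suffices; at the first failure its cube equals `suc d` exactly, so doubling s gives a
-- cube of exactly `8 * suc d`.
cubeRoot : ∀ d → ∃[ s ] suc d ≤ s ^ 3 × s ^ 3 ≤ 8 * suc d
cubeRoot zero = 1 , s≤s z≤n , s≤s z≤n
cubeRoot (suc d) with cubeRoot d
... | s , d≤ , ≤8d with suc (suc d) ≤? s ^ 3
...   | yes d<s³ = s , d<s³ , ≤-trans ≤8d (*-monoʳ-≤ 8 (n≤1+n (suc d)))
...   | no  d≮s³ = 2 * s , ≤-trans below (≤-reflexive (sym cube)) ,
                   ≤-trans (≤-reflexive cube) (*-monoʳ-≤ 8 (n≤1+n (suc d)))
  where
  s³≡ : s ^ 3 ≡ suc d
  s³≡ = ≤-antisym (s≤s⁻¹ (≰⇒> d≮s³)) d≤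
  e : ∀ s → 2 * s * (2 * s * (2 * s * 1)) ≡ 8 * (s * (s * (s * 1)))
  e = solve-∀
  cube : (2 * s) ^ 3 ≡ 8 * suc d
  cube = trans (e s) (cong (8 *_) s³≡)
  below : suc (suc d) ≤ 8 * suc d
  below = ≤-trans (s≤s (m≤n+m (suc d) d)) (≤-trans (≤-reflexive (cong (λ z → suc d + z) (sym (*-identityˡ (suc d))))) (*-monoˡ-≤ (suc d) (m≤m+n 2 6)))

-- The d edges at one vertex are distinct entries of the list, and a `Simple` list is no longer than
-- the list it is taken from. The prefix length is immaterial here and is set to 0.
d≤∣qEdges∣ : ∀ d → d ≤ length (qEdges d)
d≤∣qEdges∣ zero      = z≤n
d≤∣qEdges∣ d@(suc _) = subst (_≤ length (qEdges d))
  (trans (length-map (near v) diagonal) (trans (length-map (λ i → i , i) (allFin d)) (length-tabulate (id {A = Fin d}))))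
  (length-Simple≤N (map (near v) diagonal) (simple-keys (Unique.map⁺ (cong proj₁) (Unique.allFin⁺ d))))
  where
  v : Vertex d
  v = replicate d false
  open At v 0 z≤n using (simple-keys)
  open Placement (_≟ₑ_ {d}) (qEdges d) 0 z≤n using (length-Simple≤N)
  diagonal = map (λ i → i , i) (allFin d)

-- Since s ≤ 2 d^{1/3}, the hypothesis d ≤ c s g yields g ≥ d^{2/3} / (2 c); this is its cubed form,
-- free of roots.
square≤cube : ∀ c d .{{_ : NonZero d}} s g → s ^ 3 ≤ 8 * d → d ≤ c * s * g → d ^ 2 ≤ (2 * c * g) ^ 3
square≤cube c d s g s³≤8d d≤csg = *-cancelˡ-≤ d (begin
  d * d ^ 2                       ≤⟨ ^-monoˡ-≤ 3 d≤csg ⟩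
  (c * s * g) ^ 3                 ≡⟨ e₁ c s g ⟩
  c ^ 3 * g ^ 3 * s ^ 3           ≤⟨ *-monoʳ-≤ (c ^ 3 * g ^ 3) s³≤8d ⟩
  c ^ 3 * g ^ 3 * (8 * d)         ≡⟨ e₂ c d g ⟩
  d * (2 * c * g) ^ 3             ∎)
  where
  open ≤-Reasoning
  e₁ : ∀ c s g → c * s * g * (c * s * g * (c * s * g * 1)) ≡ c * (c * (c * 1)) * (g * (g * (g * 1))) * (s * (s * (s * 1)))
  e₁ = solve-∀
  e₂ : ∀ c d g → c * (c * (c * 1)) * (g * (g * (g * 1))) * (8 * d) ≡ d * (2 * c * g * (2 * c * g * (2 * c * g * 1)))
  e₂ = solve-∀

-- With r = 4 s, Y is at least d / (16 s) and X at most d / (32 s), so g is at least d / (32 s). The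
-- factor 64 is 2 · 32.
degree-lower-bound : ∀ d .{{_ : NonZero d}} s g X Y → s ^ 3 ≤ 8 * d → Y ≤ g + X →
  d ≤ 4 * (4 * s) * Y → 8 * (4 * s) * X ≤ d → d ^ 2 ≤ (64 * g) ^ 3
degree-lower-bound d s g X Y s³≤8d Y≤ d≤Y X≤d = square≤cube 32 d s g s³≤8d (+-cancelʳ-≤ d d (32 * s * g) (begin
  d + d                              ≡⟨ cong (d +_) (sym (+-identityʳ d)) ⟩
  2 * d                              ≤⟨ *-monoʳ-≤ 2 d≤Y ⟩
  2 * (4 * (4 * s) * Y)              ≡⟨ e₁ s Y ⟩
  32 * s * Y                         ≤⟨ *-monoʳ-≤ (32 * s) Y≤ ⟩
  32 * s * (g + X)                   ≡⟨ e₂ s g X ⟩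
  32 * s * g + 8 * (4 * s) * X       ≤⟨ +-monoʳ-≤ (32 * s * g) X≤d ⟩
  32 * s * g + d                     ∎))
  where
  open ≤-Reasoning
  e₁ : ∀ s Y → 2 * (4 * (4 * s) * Y) ≡ 32 * s * Y
  e₁ = solve-∀
  e₂ : ∀ s g X → 32 * s * (g + X) ≡ 32 * s * g + 8 * (4 * s) * X
  e₂ = solve-∀

<ᵇ-false : ∀ a b → b ≤ a → (a <ᵇ b) ≡ false
<ᵇ-false a b b≤a = go (a <ᵇ b) refl
  where
  go : ∀ c → (a <ᵇ b) ≡ c → c ≡ false
  go false _  = refl
  go true  eq = contradiction (<ᵇ⇒< a b (Equivalence.from T-≡ eq)) (≤⇒≯ b≤a)

≤ᵇ-false : ∀ a b → (a ≤ᵇ b) ≡ false → b ≤ a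
≤ᵇ-false a b eq with a ≤? b
... | no a≰b  = <⇒≤ (≰⇒> a≰b)
... | yes a≤b = contradiction (trans (sym eq) (Equivalence.to T-≡ (≤⇒≤ᵇ a≤b))) λ ()

low : ∀ {d} → Vertex d → List (Edge d) → ℕ
low {d} v σ = 𝟙 (lowDegree {d} 1 64 (degree (finalGraph σ) v))

-- A union bound over the two exceptional events, with 112 s = (16 + 12) · r for r = 4 s.
low-rare : ∀ d .{{_ : NonZero d}} s .{{_ : NonZero s}} → d ≤ s ^ 3 → s ^ 3 ≤ 8 * d → ∀ K .{{_ : NonZero K}} →
  112 * s * K ≤ d → (v : Vertex d) → ∑ (perms (qEdges d)) (low v) * K ≤ length (perms (qEdges d))
low-rare d s d≤s³ s³≤8d K large v = *-cancelʳ-≤ _ _ d (begin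
  ∑ Ω (low v) * K * d                          ≤⟨ *-monoˡ-≤ d (*-monoˡ-≤ K (∑-mono Ω low≤)) ⟩
  ∑[ σ ∈ Ω ] (few σ + many σ) * K * d          ≡⟨ cong (λ z → z * K * d) (∑-distrib-+ Ω few many) ⟩
  (∑ Ω few + ∑ Ω many) * K * d                 ≡⟨ e₁ (∑ Ω few) (∑ Ω many) K d ⟩
  K * (∑ Ω few * d + ∑ Ω many * d)             ≤⟨ *-monoʳ-≤ K (+-mono-≤ few-early many-early-squares) ⟩
  K * (16 * r * length Ω + 12 * r * length Ω)  ≡⟨ e₂ K s (length Ω) ⟩
  length Ω * (112 * s * K)                     ≤⟨ *-monoʳ-≤ (length Ω) large ⟩
  length Ω * d                                 ∎)
  where
  open ≤-Reasoning
  Ω = perms (qEdges d)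
  N = length (qEdges d)
  -- The factor 4 turns d ≤ s³ into 64 d ≤ r³.
  r = 4 * s
  instance
    r≢0 : NonZero r
    r≢0 = m*n≢0 4 s
  m = N / r
  r≤N : r ≤ N
  r≤N = begin
    4 * s             ≤⟨ *-monoˡ-≤ s (m≤m+n 4 108) ⟩
    112 * s           ≤⟨ m≤m*n (112 * s) K ⟩
    112 * s * K       ≤⟨ large ⟩
    d                 ≤⟨ d≤∣qEdges∣ d ⟩
    N                 ∎
  -- As r ≤ N, the quotient m is at least 1, so the remainder, being below r, is at most m r.
  N≤2mr : N ≤ 2 * (m * r)
  N≤2mr = begin
    N                   ≡⟨ m≡m%n+[m/n]*n N r ⟩
    N % r + m * r       ≤⟨ +-monoˡ-≤ (m * r) (<⇒≤ (m%n<n N r)) ⟩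
    r + m * r           ≤⟨ +-monoˡ-≤ (m * r) (m≤n*m r m {{>-nonZero (m≥n⇒m/n>0 r≤N)}}) ⟩
    m * r + m * r       ≡⟨ cong (m * r +_) (sym (+-identityʳ (m * r))) ⟩
    2 * (m * r)         ∎
  e₀ : ∀ s → 64 * (s * (s * (s * 1))) ≡ 4 * s * (4 * s * (4 * s * 1))
  e₀ = solve-∀
  open At v m (m/n≤m N r)
  open Bounds r (m/n*n≤m N r) N≤2mr (≤-trans (>-nonZero⁻¹ r) r≤N)
    (≤-trans (*-monoʳ-≤ 64 d≤s³) (≤-reflexive (e₀ s)))
  few many : List (Edge d) → ℕ
  few  σ = 𝟙 (4 * r * Diagonal.count σ ≤ᵇ d)
  many σ = 𝟙 (d ≤ᵇ 8 * r * OffDiagonal.count σ)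
  low≤ : ∀ σ → σ ∈ Ω → low v σ ≤ few σ + many σ
  low≤ σ σ∈ = split (4 * r * Diagonal.count σ ≤ᵇ d) (d ≤ᵇ 8 * r * OffDiagonal.count σ) refl refl
    where
    g = degree (finalGraph σ) v
    split : ∀ a b → (4 * r * Diagonal.count σ ≤ᵇ d) ≡ a → (d ≤ᵇ 8 * r * OffDiagonal.count σ) ≡ b → low v σ ≤ 𝟙 a + 𝟙 b
    split true  b     _  _   = ≤-trans (𝟙≤1 (lowDegree {d} 1 64 g)) (s≤s z≤n)
    split false true  _  _   = 𝟙≤1 (lowDegree {d} 1 64 g)
    split false false eq eq′ = ≤-reflexive (cong 𝟙 (<ᵇ-false ((64 * g) ^ 3) (1 ^ 3 * d ^ 2)
      (≤-trans (≤-reflexive (*-identityˡ (d ^ 2)))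
        (degree-lower-bound d s g (OffDiagonal.count σ) (Diagonal.count σ) s³≤8d (early≤degree+squares σ∈)
          (≤ᵇ-false (4 * r * Diagonal.count σ) d eq) (≤ᵇ-false d (8 * r * OffDiagonal.count σ) eq′)))))
  e₁ : ∀ a b K d → (a + b) * K * d ≡ K * (a * d + b * d)
  e₁ = solve-∀
  e₂ : ∀ K s T → K * (16 * (4 * s) * T + 12 * (4 * s) * T) ≡ T * (112 * s * K)
  e₂ = solve-∀

-- If c s K exceeded d, `square≤cube` would give d² ≤ D³ for D = 2 c K, whereas D² ≤ d gives d² ≥ D⁴
-- > D³.
large-enough : ∀ c .{{_ : NonZero c}} d .{{_ : NonZero d}} s K .{{_ : NonZero K}} →
  s ^ 3 ≤ 8 * d → (2 * c * K) ^ 2 ≤ d → c * s * K ≤ d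
large-enough c d s K s³≤8d D²≤d with c * s * K ≤? d
... | yes ≤d = ≤d
... | no  ≰d = contradiction d≤D (<⇒≱ D<d)
  where
  open ≤-Reasoning
  D = 2 * c * K
  D≢0 : NonZero (c * K)
  D≢0 = m*n≢0 c K
  2≤D : 2 ≤ D
  2≤D = begin
    2             ≤⟨ m≤m*n 2 (c * K) {{D≢0}} ⟩
    2 * (c * K)   ≡⟨ sym (*-assoc 2 c K) ⟩
    D             ∎
  d≤D : d ^ 2 ≤ D ^ 3
  d≤D = square≤cube c d s K s³≤8d (<⇒≤ (≰⇒> ≰d))
  fourth : ∀ x → x * (x * (x * (x * 1))) ≡ x * (x * 1) * (x * (x * 1) * 1)
  fourth = solve-∀
  D<d : D ^ 3 < d ^ 2
  D<d = begin-strict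
    D ^ 3         ≡⟨ sym (*-identityˡ (D ^ 3)) ⟩
    1 * D ^ 3     <⟨ *-monoˡ-< (D ^ 3) {{m^n≢0 D 3 {{>-nonZero (≤-trans (s≤s z≤n) 2≤D)}}}} 2≤D ⟩
    D * D ^ 3     ≡⟨ fourth D ⟩
    (D ^ 2) ^ 2   ≤⟨ ^-monoˡ-≤ 2 D²≤d ⟩
    d ^ 2         ∎

∑-samples : ∀ d (f : List (Edge d) × Vertex d → ℕ) →
  ∑ (samples d) f ≡ ∑[ v ∈ allV d ] ∑[ σ ∈ perms (qEdges d) ] f (σ , v)
∑-samples d f = trans (∑-concatMap _ (perms (qEdges d)) f)
  (trans (∑-cong (perms (qEdges d)) (λ σ _ → ∑-map (σ ,_) (allV d) f)) (∑-swap (perms (qEdges d)) (allV d) _))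

-- The estimate holds at every fixed vertex, so averaging over a random one loses nothing and no
-- symmetry of the cube is used.
low-rare⇒bad-rare : ∀ d K → (∀ v → ∑ (perms (qEdges d)) (low v) * K ≤ length (perms (qEdges d))) →
  badCount d 1 64 * K ≤ totalCount d
low-rare⇒bad-rare d K rare = begin
  badCount d 1 64 * K
    ≡⟨ cong (_* K) (trans (length-filterᵇ _ (samples d)) (∑-samples d _)) ⟩
  ∑[ v ∈ allV d ] ∑ Ω (low v) * K
    ≡⟨ sym (∑-*ʳ (allV d) K _) ⟩
  ∑[ v ∈ allV d ] (∑ Ω (low v) * K)
    ≤⟨ ∑-mono (allV d) (λ v _ → ≤-trans (rare v) (≤-reflexive (length-∑ Ω))) ⟩
  ∑[ v ∈ allV d ] ∑[ _ ∈ Ω ] 1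
    ≡⟨ sym (trans (length-∑ (samples d)) (∑-samples d _)) ⟩
  totalCount d ∎
  where
  open ≤-Reasoning
  Ω = perms (qEdges d)

theorem2p2 : Σ ℕ λ p → Σ ℕ λ q → (p > 0) × (q > 0) ×
    ((k : ℕ) → Σ ℕ λ D → (d : ℕ) → D ≤ d →
    badCount d p q * suc k ≤ totalCount d)
-- The witness is c = 1 / 64. The threshold for d is that of `large-enough` with constant 112, and
-- its successor makes d positive.
theorem2p2 = 1 , 64 , s≤s z≤n , s≤s z≤n , λ k → suc ((2 * 112 * suc k) ^ 2) , tail k
  where
  tail : ∀ k d → (2 * 112 * suc k) ^ 2 < d → badCount d 1 64 * suc k ≤ totalCount d
  tail k (suc d) D<d with cubeRoot d
  -- The case s = 0 is absurd, since it would give `suc d ≤ 0`.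
  ... | suc s , d≤s³ , s³≤8d = low-rare⇒bad-rare (suc d) (suc k)
    (low-rare (suc d) (suc s) d≤s³ s³≤8d (suc k) (large-enough 112 (suc d) (suc s) (suc k) s³≤8d (<⇒≤ D<d)))
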